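{- Let $k,j\ge 0$ and $m\ge 1$ be integers and put $n=2m+kj$ (so $n\ge 1$). Then, as polynomials in the indeterminates $t_1,t_2,\dots$, $$\sum_{P\in\mathfrak{P}_{n,k}^{m,j}}\prod_{i\geq1}t_i^{\beta_i(P)}=\sum_{p=0}^{m}\left\{\frac{m-p}{m+j}\binom{m+j}{j}+\frac{m-p+1}{m+j}\binom{m+j}{j-1}\right\}\frac{\mathbf{P}_{p}^{(m+j)}\big(1!\,t_1,2!\,t_2,\dots\big)}{p!}$$ $$=\binom{m+j}{j}\sum_{p=0}^{m}\frac{(m+1)(m-p)+j(m-p+1)}{(m+1)(m+j)}\sum_{r=0}^{p}\binom{m+j}{r}\frac{r!}{p!}\,\mathbf{B}_{p,r}\big(1!\,t_1,2!\,t_2,\dots\big).$$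
   Context: Fix an integer $k\ge 0$. Lattice paths use the steps $u=(1,1)$ (up-step), $d=(1,-1)$ (down-step), $h=(k,0)$ (horizontal-step), and a path is regarded as the sequence (word in the letters $u,d,h$) of its steps; for $k=0$ the letter $h$ is a formal letter not changing the position. A $k$-path of length $n$ is such a path from $(0,0)$ to $(n,0)$ that never goes below the $x$-axis. $\mathfrak{P}_{n,k}^{m,j}$ is the set of $k$-paths with exactly $m$ up-steps and $j$ horizontal-steps (hence $m$ down-steps and $n=2m+kj$). A $u$-segment of a path is a maximal sequence of consecutive up-steps. An internal $u$-segment is a $u$-segment lying between two steps each of which is $d$ or $h$; that is, every $u$-segment except one with which the path begins (a $u$-segment preceded by an $h$ is internal, even if it is the leftmost one). $\beta_i(P)$ is the number of internal $u$-segments of length $i$ in $P$. $\mathbf{B}_{p,r}(x_1,x_2,\dots)$ is the partial Bell polynomial $\sum \frac{p!}{r_1!r_2!\cdots r_p!}\left(\frac{x_1}{1!}\right)^{r_1}\cdots\left(\frac{x_p}{p!}\right)^{r_p}$, the sum being over nonnegative integers with $r_1+\cdots+r_p=r$ and $r_1+2r_2+\cdots+pr_p=p$ (so $\mathbf{B}_{0,0}=1$, $\mathbf{B}_{p,0}=0$ for $p\ge1$). The potential polynomials $\mathbf{P}_p^{(\lambda)}=\mathbf{P}_p^{(\lambda)}(f_1,f_2,\dots)$ are defined by $\mathbf{P}_0^{(\lambda)}=1$ and $1+\sum_{p\ge1}\mathbf{P}_p^{(\lambda)}\frac{x^p}{p!}=\Big(1+\sum_{p\ge1}f_p\frac{x^p}{p!}\Big)^{\lambda}$.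 Convention: $\binom{a}{ -1}=0$. -}

module Defs where

open import Algebra.Bundles using (CommutativeRing; Semiring)
open import Data.Integer.Base as ℤ using (ℤ; +_; -[1+_])
import Data.Integer.Properties as ℤ
open import Data.Bool.Base using (Bool; true; false; if_then_else_)
open import Data.Fin.Base as Fin using (Fin; toℕ)
open import Data.List.Base using (List; []; _∷_; map; foldr; foldl; filter; length; upTo; allFin; cartesianProductWith)
import Data.List.Properties as List
open import Data.List.Membership.Propositional using (_∈_)
open import Data.List.Membership.Propositional.Properties using (∈-map⁺; ∈-upTo⁺; ∈-filter⁺; ∈-filter⁻; ∈-cartesianProductWith⁺)
open import Data.List.Relation.Unary.All using (All; []; _∷_; all?)
open import Data.List.Relation.Unary.Any using (here; there)
open import Data.List.Relation.Unary.AllPairs using ([]; _∷_)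
open import Data.List.Relation.Unary.Unique.Propositional using (Unique)
import Data.List.Relation.Unary.Unique.Propositional.Properties as Unique
open import Data.Nat.Base as ℕ using (ℕ; zero; suc; NonZero; _!)
open import Data.Nat.Combinatorics using (_C_)
import Data.Nat.Properties as ℕ
open import Data.Product.Base using (_×_; _,_; proj₁; proj₂)
open import Data.Product.Properties using (≡-dec)
open import Data.Rational.Base as ℚ using (ℚ; 0ℚ; 1ℚ)
import Data.Rational.Properties as ℚ
open import Data.Vec.Base as Vec using (Vec; []; _∷_; lookup)
import Data.Vec.Properties as Vec
open import Function.Base using (_∘_)
open import Function.Bundles using (_⇔_; mk⇔)
open import Level using (0ℓ)
open import Relation.Binary.PropositionalEquality
open import Relation.Binary.Structures using (IsEquivalence)
open import Relation.Nullary.Decidable using (Dec; yes; no; _×-dec_)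
open import Relation.Unary using (Decidable)

-- ℚ[t₀, t₁, t₂, …] with tᵢ = var i (t₀ plays no role): the free commutative
-- ℚ-algebra on the variables, i.e. ring expressions modulo the least
-- congruence containing the commutative ring laws and making `con` a ring
-- homomorphism.

infix  4 _≈_
infixl 6 _+_
infixl 7 _*_
infix  8 -_

data Poly : Set where
  con     : ℚ → Poly
  var     : ℕ → Poly
  _+_ _*_ : Poly → Poly → Poly
  -_      : Poly → Poly

data _≈_ : Poly → Poly → Set where
  ≈-refl      : ∀ {x} → x ≈ x
  ≈-sym       : ∀ {x y} → x ≈ y → y ≈ x
  ≈-trans     : ∀ {x y z} → x ≈ y → y ≈ z → x ≈ z
  +-cong      : ∀ {x x′ y y′} → x ≈ x′ → y ≈ y′ → x + y ≈ x′ + y′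
  *-cong      : ∀ {x x′ y y′} → x ≈ x′ → y ≈ y′ → x * y ≈ x′ * y′
  neg-cong    : ∀ {x x′} → x ≈ x′ → - x ≈ - x′
  +-assoc     : ∀ x y z → (x + y) + z ≈ x + (y + z)
  +-comm      : ∀ x y → x + y ≈ y + x
  +-identityˡ : ∀ x → con 0ℚ + x ≈ x
  +-inverseˡ  : ∀ x → - x + x ≈ con 0ℚ
  *-assoc     : ∀ x y z → (x * y) * z ≈ x * (y * z)
  *-comm      : ∀ x y → x * y ≈ y * x
  *-identityˡ : ∀ x → con 1ℚ * x ≈ x
  *-distribʳ  : ∀ x y z → (y + z) * x ≈ y * x + z * x
  con-+       : ∀ p q → con (p ℚ.+ q) ≈ con p + con q
  con-*       : ∀ p q → con (p ℚ.* q) ≈ con p * con q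

polyRing : CommutativeRing 0ℓ 0ℓ
polyRing = record
  { Carrier = Poly ; _≈_ = _≈_ ; _+_ = _+_ ; _*_ = _*_ ; -_ = -_
  ; 0# = con 0ℚ ; 1# = con 1ℚ
  ; isCommutativeRing = record
    { isRing = record
      { +-isAbelianGroup = record
        { isGroup = record
          { isMonoid = record
            { isSemigroup = record
              { isMagma = record { isEquivalence = isEquiv ; ∙-cong = +-cong }
              ; assoc = +-assoc }
            ; identity = +-identityˡ , λ x → ≈-trans (+-comm _ _) (+-identityˡ x) }
          ; inverse = +-inverseˡ , λ x → ≈-trans (+-comm _ _) (+-inverseˡ x)
          ; ⁻¹-cong = neg-cong }
        ; comm = +-comm }
      ; *-cong = *-cong
      ; *-assoc = *-assoc
      ; *-identity = *-identityˡ , λ x → ≈-trans (*-comm _ _) (*-identityˡ x)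
      ; distrib = (λ x y z → ≈-trans (*-comm _ _)
                      (≈-trans (*-distribʳ x y z) (+-cong (*-comm _ _) (*-comm _ _))))
                , *-distribʳ }
    ; *-comm = *-comm } }
  where
  isEquiv : IsEquivalence _≈_
  isEquiv = record { refl = ≈-refl ; sym = ≈-sym ; trans = ≈-trans }

open import Algebra.Definitions.RawSemiring (Semiring.rawSemiring (CommutativeRing.semiring polyRing)) public using (_^_)

-- Evaluation at a rational point respects _≈_, so _≈_ does not identify
-- polynomials that differ as polynomial functions on ℚ^ℕ (hence, ℚ being
-- infinite, it identifies no two distinct polynomials).

eval : (ℕ → ℚ) → Poly → ℚ
eval ρ (con q) = q
eval ρ (var i) = ρ i
eval ρ (x + y) = eval ρ x ℚ.+ eval ρ y
eval ρ (x * y) = eval ρ x ℚ.* eval ρ y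
eval ρ (- x)   = ℚ.- eval ρ x

eval-cong : ∀ ρ {x y} → x ≈ y → eval ρ x ≡ eval ρ y
eval-cong ρ ≈-refl            = refl
eval-cong ρ (≈-sym e)         = sym (eval-cong ρ e)
eval-cong ρ (≈-trans e f)     = trans (eval-cong ρ e) (eval-cong ρ f)
eval-cong ρ (+-cong e f)      = cong₂ ℚ._+_ (eval-cong ρ e) (eval-cong ρ f)
eval-cong ρ (*-cong e f)      = cong₂ ℚ._*_ (eval-cong ρ e) (eval-cong ρ f)
eval-cong ρ (neg-cong e)      = cong ℚ.-_ (eval-cong ρ e)
eval-cong ρ (+-assoc x y z)   = ℚ.+-assoc (eval ρ x) (eval ρ y) (eval ρ z)
eval-cong ρ (+-comm x y)      = ℚ.+-comm (eval ρ x) (eval ρ y)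
eval-cong ρ (+-identityˡ x)   = ℚ.+-identityˡ (eval ρ x)
eval-cong ρ (+-inverseˡ x)    = ℚ.+-inverseˡ (eval ρ x)
eval-cong ρ (*-assoc x y z)   = ℚ.*-assoc (eval ρ x) (eval ρ y) (eval ρ z)
eval-cong ρ (*-comm x y)      = ℚ.*-comm (eval ρ x) (eval ρ y)
eval-cong ρ (*-identityˡ x)   = ℚ.*-identityˡ (eval ρ x)
eval-cong ρ (*-distribʳ x y z) = ℚ.*-distribʳ-+ (eval ρ x) (eval ρ y) (eval ρ z)
eval-cong ρ (con-+ p q)       = refl
eval-cong ρ (con-* p q)       = refl

infixr 7 _·_
_·_ : ℚ → Poly → Poly
q · x = con q * x

infix 5 sumOver productOver

sumOver productOver : ∀ {A : Set} → List A → (A → Poly) → Poly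
sumOver     xs f = foldr (λ a s → f a + s) (con 0ℚ) xs
productOver xs f = foldr (λ a s → f a * s) (con 1ℚ) xs

syntax sumOver     xs (λ x → e) = ∑[ x ∈ xs ] e
syntax productOver xs (λ x → e) = ∏[ x ∈ xs ] e

0to 1to : ℕ → List ℕ
0to n = upTo (suc n)
1to n = map suc (upTo n)

fromℕ : ℕ → ℚ
fromℕ n = + n ℚ./ 1

1/!_ : ℕ → ℚ
1/! n = (+ 1 ℚ./ n !) {{n ℕ.!≢0}}

-- Lower index in ℤ, with the convention that it is 0 there when negative.
binomial : ℕ → ℤ → ℚ
binomial a (+ b)    = fromℕ (a C b)
binomial a -[1+ _ ] = 0ℚ

+-nonZeroˡ : ∀ m n .{{_ : NonZero m}} → NonZero (m ℕ.+ n)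
+-nonZeroˡ (suc _) _ = _

tuples : ∀ {A : Set} → List A → (n : ℕ) → List (Vec A n)
tuples xs zero    = [] ∷ []
tuples xs (suc n) = cartesianProductWith _∷_ xs (tuples xs n)

-- A sequence (f₁, f₂, …) is a function ℕ → Poly whose value at 0 is never
-- used; a formal power series is its sequence of coefficients.

Series : Set
Series = ℕ → Poly

infixl 7 _⋆_
_⋆_ : Series → Series → Series
(F ⋆ G) n = ∑[ i ∈ 0to n ] F i * G (n ℕ.∸ i)

1ˢ : Series
1ˢ zero    = con 1ℚ
1ˢ (suc _) = con 0ℚ

infixr 8 _^ˢ_
_^ˢ_ : Series → ℕ → Series
F ^ˢ zero  = 1ˢ
F ^ˢ suc l = F ⋆ (F ^ˢ l)

-- 1 + Σ_{p ≥ 1} f_p x^p / p!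
1+egf : (ℕ → Poly) → Series
1+egf f zero    = con 1ℚ
1+egf f (suc p) = 1/! (suc p) · f (suc p)

-- 𝐏 p l f is the potential polynomial of index p and exponent l, at f.
𝐏 : ℕ → ℕ → (ℕ → Poly) → Poly
𝐏 p l f = fromℕ (p !) · (1+egf f ^ˢ l) p

-- The entry of r at position i : Fin p stands for r_{i+1}.

IsBellIndex : (p r : ℕ) → Vec ℕ p → Set
IsBellIndex p r rs =
  Vec.sum rs ≡ r × Vec.sum (Vec.tabulate λ i → suc (toℕ i) ℕ.* lookup rs i) ≡ p

isBellIndex? : ∀ p r → Decidable (IsBellIndex p r)
isBellIndex? p r rs = (_ ℕ.≟ _) ×-dec (_ ℕ.≟ _)

-- The condition r₁ + 2r₂ + ⋯ + p r_p = p forces every r_i ≤ p, so no index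
-- is missed (see ∈-bellIndices below).
bellIndices : (p r : ℕ) → List (Vec ℕ p)
bellIndices p r = filter (isBellIndex? p r) (tuples (0to p) p)

∏! : ∀ {n} → Vec ℕ n → ℕ
∏! []       = 1
∏! (r ∷ rs) = r ! ℕ.* ∏! rs

∏!≢0 : ∀ {n} (rs : Vec ℕ n) → NonZero (∏! rs)
∏!≢0 []       = _
∏!≢0 (r ∷ rs) = ℕ.m*n≢0 (r !) (∏! rs) {{r ℕ.!≢0}} {{∏!≢0 rs}}

𝐁 : (p r : ℕ) → (ℕ → Poly) → Poly
𝐁 p r x =
  ∑[ rs ∈ bellIndices p r ]
    (((+ (p !) ℚ./ ∏! rs) {{∏!≢0 rs}}) ·
      (∏[ i ∈ allFin p ] (1/! suc (toℕ i) · x (suc (toℕ i))) ^ lookup rs i))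

data Step : Set where
  u d h : Step

_≟_ : (s s′ : Step) → Dec (s ≡ s′)
u ≟ u = yes refl
u ≟ d = no λ ()
u ≟ h = no λ ()
d ≟ u = no λ ()
d ≟ d = yes refl
d ≟ h = no λ ()
h ≟ u = no λ ()
h ≟ d = no λ ()
h ≟ h = yes refl

Point : Set
Point = ℤ × ℤ

move : ℕ → Point → Step → Point
move k (x , y) u = x ℤ.+ + 1 , y ℤ.+ + 1
move k (x , y) d = x ℤ.+ + 1 , y ℤ.- + 1
move k (x , y) h = x ℤ.+ + k , y

vertices : ℕ → Point → List Step → List Point
vertices k a []      = a ∷ []
vertices k a (s ∷ w) = a ∷ vertices k (move k a s) w

endpoint : ℕ → Point → List Step → Point
endpoint k = foldl (move k)

# : Step → List Step → ℕ
# s w = length (filter (s ≟_) w)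

IsPath : (k n : ℕ) → List Step → Set
IsPath k n w =
    All (λ a → + 0 ℤ.≤ proj₂ a) (vertices k (+ 0 , + 0) w)
  × endpoint k (+ 0 , + 0) w ≡ (+ n , + 0)

In𝔓 : (k n m j : ℕ) → List Step → Set
In𝔓 k n m j w = IsPath k n w × # u w ≡ m × # h w ≡ j

in𝔓? : ∀ k n m j → Decidable (In𝔓 k n m j)
in𝔓? k n m j w =
  (all? (λ a → + 0 ℤ.≤? proj₂ a) _ ×-dec ≡-dec ℤ._≟_ ℤ._≟_ _ _)
  ×-dec (# u w ℕ.≟ m) ×-dec (# h w ℕ.≟ j)

words : ℕ → List (List Step)
words l = map Vec.toList (tuples (u ∷ d ∷ h ∷ []) l)

-- The set of paths as a duplicate-free list (see ∈-𝔓 and 𝔓-unique below):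
-- such a path has m down-steps, hence 2m + j steps.
𝔓 : (k n m j : ℕ) → List (List Step)
𝔓 k n m j = filter (in𝔓? k n m j) (words (2 ℕ.* m ℕ.+ j))

-- The word begins with exactly i up-steps, followed by a step d or h.
beginsWith : ℕ → List Step → Bool
beginsWith zero    (d ∷ w) = true
beginsWith zero    (h ∷ w) = true
beginsWith (suc i) (u ∷ w) = beginsWith i w
beginsWith _       _       = false

-- For i ≥ 1, the number of internal u-segments of length i, i.e. of
-- occurrences of a factor a uⁱ b with a , b ∈ {d , h}.
β : ℕ → List Step → ℕ
β i []      = 0
β i (u ∷ w) = β i w
β i (d ∷ w) = (if beginsWith i w then 1 else 0) ℕ.+ β i w
β i (h ∷ w) = (if beginsWith i w then 1 else 0) ℕ.+ β i w

-- ∏_{i ≥ 1} t_i^{β_i(P)}; by β-beyond-length below, all further factors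
-- are 1.
weight : List Step → Poly
weight P = ∏[ i ∈ 1to (length P) ] var i ^ β i P

beginsWith-length : ∀ i w → length w ℕ.≤ i → beginsWith i w ≡ false
beginsWith-length zero    []      _  = refl
beginsWith-length (suc i) []      _  = refl
beginsWith-length (suc i) (u ∷ w) le = beginsWith-length i w (ℕ.s≤s⁻¹ le)
beginsWith-length (suc i) (d ∷ w) _  = refl
beginsWith-length (suc i) (h ∷ w) _  = refl

β-beyond-length : ∀ i w → length w ℕ.≤ i → β i w ≡ 0
β-beyond-length i []      _  = refl
β-beyond-length i (u ∷ w) le = β-beyond-length i w (ℕ.<⇒≤ le)
β-beyond-length i (d ∷ w) le
  rewrite beginsWith-length i w (ℕ.<⇒≤ le) = β-beyond-length i w (ℕ.<⇒≤ le)
β-beyond-length i (h ∷ w) le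
  rewrite beginsWith-length i w (ℕ.<⇒≤ le) = β-beyond-length i w (ℕ.<⇒≤ le)

∈-tuples : ∀ {A : Set} {xs : List A} {n} (v : Vec A n) →
           (∀ i → lookup v i ∈ xs) → v ∈ tuples xs n
∈-tuples []      _  = here refl
∈-tuples (x ∷ v) v∈ =
  ∈-cartesianProductWith⁺ _∷_ (v∈ Fin.zero) (∈-tuples v (v∈ ∘ Fin.suc))

tuples-unique : ∀ {A : Set} {xs : List A} n → Unique xs → Unique (tuples xs n)
tuples-unique zero    _  = [] ∷ []
tuples-unique (suc n) xs! =
  Unique.cartesianProductWith⁺ _∷_ Vec.∷-injective xs! (tuples-unique n xs!)

private
  lookup≤sum : ∀ {n} (f : Fin n → ℕ) i → f i ℕ.≤ Vec.sum (Vec.tabulate f)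
  lookup≤sum f Fin.zero    = ℕ.m≤m+n _ _
  lookup≤sum f (Fin.suc i) = ℕ.≤-trans (lookup≤sum (f ∘ Fin.suc) i) (ℕ.m≤n+m _ _)

∈-bellIndices : ∀ p r rs → rs ∈ bellIndices p r ⇔ IsBellIndex p r rs
∈-bellIndices p r rs = mk⇔
  (λ rs∈ → proj₂ (∈-filter⁻ (isBellIndex? p r) {xs = tuples (0to p) p} rs∈))
  (λ ok → ∈-filter⁺ (isBellIndex? p r) (∈-tuples rs (λ i → ∈-upTo⁺ (ℕ.s≤s (bound ok i)))) ok)
  where
  bound : IsBellIndex p r rs → ∀ i → lookup rs i ℕ.≤ p
  bound (_ , eq) i = ℕ.≤-trans (ℕ.m≤m+n _ _)
    (ℕ.≤-trans (lookup≤sum (λ i → suc (toℕ i) ℕ.* lookup rs i) i) (ℕ.≤-reflexive eq))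

bellIndices-unique : ∀ p r → Unique (bellIndices p r)
bellIndices-unique p r =
  Unique.filter⁺ (isBellIndex? p r) (tuples-unique p (Unique.upTo⁺ (suc p)))

private
  length-# : ∀ w → length w ≡ # u w ℕ.+ # d w ℕ.+ # h w
  length-# []      = refl
  length-# (u ∷ w) = cong suc (length-# w)
  length-# (d ∷ w) = trans (cong suc (length-# w))
                           (cong (ℕ._+ # h w) (sym (ℕ.+-suc (# u w) (# d w))))
  length-# (h ∷ w) = trans (cong suc (length-# w)) (sym (ℕ.+-suc _ (# h w)))

  height-# : ∀ k x y w → proj₂ (endpoint k (x , y) w) ℤ.+ + # d w ≡ y ℤ.+ + # u w
  height-# k x y []      = refl
  height-# k x y (u ∷ w) =
    trans (height-# k _ _ w) (ℤ.+-assoc y (+ 1) (+ # u w))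
  height-# k x y (h ∷ w) = height-# k _ _ w
  height-# k x y (d ∷ w) = begin
    e ℤ.+ + suc (# d w)              ≡⟨ cong (λ z → e ℤ.+ z) (ℤ.+-comm (+ 1) (+ # d w)) ⟩
    e ℤ.+ (+ # d w ℤ.+ + 1)          ≡⟨ ℤ.+-assoc e (+ # d w) (+ 1) ⟨
    e ℤ.+ + # d w ℤ.+ + 1            ≡⟨ cong (ℤ._+ + 1) (height-# k _ _ w) ⟩
    y ℤ.- + 1 ℤ.+ + # u w ℤ.+ + 1    ≡⟨ ℤ.+-assoc (y ℤ.- + 1) (+ # u w) (+ 1) ⟩
    y ℤ.- + 1 ℤ.+ (+ # u w ℤ.+ + 1)  ≡⟨ cong (λ z → y ℤ.- + 1 ℤ.+ z) (ℤ.+-comm (+ # u w) (+ 1)) ⟩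
    y ℤ.- + 1 ℤ.+ (+ 1 ℤ.+ + # u w)  ≡⟨ ℤ.+-assoc (y ℤ.- + 1) (+ 1) (+ # u w) ⟨
    y ℤ.- + 1 ℤ.+ + 1 ℤ.+ + # u w    ≡⟨ cong (ℤ._+ + # u w) (ℤ.+-assoc y (ℤ.- + 1) (+ 1)) ⟩
    y ℤ.+ + 0 ℤ.+ + # u w            ≡⟨ cong (ℤ._+ + # u w) (ℤ.+-identityʳ y) ⟩
    y ℤ.+ + # u w                    ∎
    where
    open ≡-Reasoning
    e = proj₂ (endpoint k (x ℤ.+ + 1 , y ℤ.- + 1) w)

  length-In𝔓 : ∀ {k n m j w} → In𝔓 k n m j w → length w ≡ 2 ℕ.* m ℕ.+ j
  length-In𝔓 {k} {n} {m} {j} {w} ((_ , end) , refl , refl) = begin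
    length w                       ≡⟨ length-# w ⟩
    # u w ℕ.+ # d w ℕ.+ # h w      ≡⟨ cong (λ z → # u w ℕ.+ z ℕ.+ # h w) #d≡#u ⟩
    # u w ℕ.+ # u w ℕ.+ # h w      ≡⟨ cong (λ z → # u w ℕ.+ z ℕ.+ # h w) (ℕ.+-identityʳ _) ⟨
    2 ℕ.* # u w ℕ.+ # h w          ∎
    where
    open ≡-Reasoning
    #d≡#u : # d w ≡ # u w
    #d≡#u = ℤ.+-injective (trans (sym (ℤ.+-identityˡ (+ # d w)))
             (trans (cong (λ a → proj₂ a ℤ.+ + # d w) (sym end))
             (trans (height-# k (+ 0) (+ 0) w) (ℤ.+-identityˡ (+ # u w)))))

  ∈-steps : ∀ s → s ∈ u ∷ d ∷ h ∷ []
  ∈-steps u = here refl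
  ∈-steps d = there (here refl)
  ∈-steps h = there (there (here refl))

  steps-unique : Unique (u ∷ d ∷ h ∷ [])
  steps-unique = ((λ ()) ∷ (λ ()) ∷ []) ∷ ((λ ()) ∷ []) ∷ [] ∷ []

  toList-injective : ∀ {n} {v w : Vec Step n} → Vec.toList v ≡ Vec.toList w → v ≡ w
  toList-injective {v = []}    {[]}    _  = refl
  toList-injective {v = _ ∷ _} {_ ∷ _} eq with List.∷-injective eq
  ... | refl , eq′ = cong (_ ∷_) (toList-injective eq′)

private
  ∈-words : ∀ w {l} → length w ≡ l → w ∈ words l
  ∈-words w refl = subst (_∈ words (length w)) (Vec.toList∘fromList w)
    (∈-map⁺ Vec.toList (∈-tuples (Vec.fromList w) (λ i → ∈-steps _)))

∈-𝔓 : ∀ k n m j w → w ∈ 𝔓 k n m j ⇔ In𝔓 k n m j w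
∈-𝔓 k n m j w = mk⇔
  (λ w∈ → proj₂ (∈-filter⁻ (in𝔓? k n m j) {xs = words (2 ℕ.* m ℕ.+ j)} w∈))
  (λ w∈ → ∈-filter⁺ (in𝔓? k n m j) (∈-words w (length-In𝔓 w∈)) w∈)

𝔓-unique : ∀ k n m j → Unique (𝔓 k n m j)
𝔓-unique k n m j = Unique.filter⁺ (in𝔓? k n m j)
  (Unique.map⁺ toList-injective (tuples-unique (2 ℕ.* m ℕ.+ j) steps-unique))

module Submission where

open import Algebra.Bundles using (CommutativeRing; CommutativeSemiring)
import Algebra.Construct.Pointwise as Pointwise
import Algebra.Definitions.RawSemiring as RawSemiring
import Algebra.Properties.CommutativeMonoid.Mult as CMMult
import Algebra.Properties.Semiring.Exp as Exp
import Algebra.Properties.Semiring.Mult as Mult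
import Algebra.Solver.Ring.NaturalCoefficients.Default as Solver
open import Algebra.Structures.Biased using (isCommutativeSemiringˡ)
open import Data.Bool.Base using (Bool; true; false; if_then_else_; _∧_)
open import Data.Fin.Base using (Fin; zero; suc; toℕ)
open import Data.Integer.Base as ℤ using (ℤ; +_)
import Data.Integer.Properties as ℤ
open import Data.List.Base using
  (List; []; _∷_; _++_; map; foldr; filter; length; upTo; allFin; tabulate; cartesianProductWith)
open import Data.List.Properties using (foldr-map; map-upTo)
open import Data.List.Relation.Unary.All using (All; []; _∷_)
open import Data.Nat.Base as ℕ using (ℕ; zero; suc; NonZero; _!; z≤n; s≤s)
open import Data.Nat.Combinatorics using (_C_; nCk+nC[k+1]≡[n+1]C[k+1]; nC1≡n; k>n⇒nCk≡0)
open import Data.Nat.Properties as ℕ using (m*n≢0)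
open import Data.Nat.Solver using (module +-*-Solver)
open import Data.Product.Base using (_,_; proj₂)
open import Data.Rational.Base as ℚ using (ℚ; 0ℚ; 1ℚ)
import Data.Rational.Properties as ℚ
import Data.Rational.Solver as ℚSolver
import Data.Rational.Unnormalised.Base as ℚᵘ
import Data.Rational.Unnormalised.Properties as ℚᵘ
open import Data.Vec.Base as Vec using (Vec; []; _∷_; lookup)
open import Defs using (0to; tuples; fromℕ; 1/!_; binomial)
open import Function.Base using (_∘_)
open import Level using (Level; 0ℓ)
open import Relation.Binary.PropositionalEquality as ≡ using (_≡_)
import Relation.Binary.Reasoning.Setoid as SetoidReasoning
open import Relation.Nullary.Decidable using (Dec; does; yes; no)
open import Relation.Nullary.Negation using (contradiction)
open import Relation.Unary using (Decidable)

-- Cut a path at its d- and h-steps: after the first u-segment and the step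
-- ending it come m + j - 1 blocks uᵃs with s ∈ {d , h} and weight tₐ (t₀ = 1).
-- Appending a final d makes them m + j blocks that lead to height -1 for the
-- first time, and a cycle lemma counts those: from height y, with n blocks of
-- which j end in h, their total weight is
--   (y + 1) / n · C(n, j) · [xᵏ] Tⁿ,   T = 1 + Σ tᵢ xⁱ,
-- where k is the number of up-steps.  By induction on the length, the first
-- block being split off, this reduces to Σ a tₐ [xᵏ⁻ᵃ] Tⁿ⁻¹ = k / n · [xᵏ] Tⁿ,
-- the coefficient form of x (Tⁿ)′ = n x T′ Tⁿ⁻¹.  Summing over the
-- length of the first u-segment gives the potential polynomials.
-- For the Bell polynomials, ∏ᵢ exp(tᵢ xⁱ z) = exp(z Σᵢ tᵢ xⁱ), compared at zʳ xᵖ,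
-- expresses the r-th power of T - 1, and Tⁿ is expanded binomially in T - 1.

-- Sums and formal power series over a commutative semiring

module Sums {c ℓ : Level} (R : CommutativeSemiring c ℓ) where
  open CommutativeSemiring R hiding (zero)
  open RawSemiring rawSemiring public using (sum; product)
  open Solver R using (solve; _:+_; _:*_; _:=_)
  open SetoidReasoning setoid

  Σ[_] : ∀ {A : Set} → List A → (A → Carrier) → Carrier
  Σ[ xs ] f = foldr (λ x s → f x + s) 0# xs

  Σ-cong : ∀ {A : Set} {f g : A → Carrier} xs → (∀ x → f x ≈ g x) → Σ[ xs ] f ≈ Σ[ xs ] g
  Σ-cong []       f≈g = refl
  Σ-cong (x ∷ xs) f≈g = +-cong (f≈g x) (Σ-cong xs f≈g)

  Σ-zero : ∀ {A : Set} (xs : List A) → Σ[ xs ] (λ _ → 0#) ≈ 0#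
  Σ-zero []       = refl
  Σ-zero (x ∷ xs) = trans (+-identityˡ _) (Σ-zero xs)

  Σ-+ : ∀ {A : Set} (f g : A → Carrier) xs → Σ[ xs ] (λ x → f x + g x) ≈ Σ[ xs ] f + Σ[ xs ] g
  Σ-+ f g []       = sym (+-identityˡ 0#)
  Σ-+ f g (x ∷ xs) = trans (+-congˡ (Σ-+ f g xs))
    (solve 4 (λ x y v w → x :+ y :+ (v :+ w) := x :+ v :+ (y :+ w)) refl (f x) (g x) _ _)

  Σ-*ˡ : ∀ {A : Set} a (f : A → Carrier) xs → Σ[ xs ] (λ x → a * f x) ≈ a * Σ[ xs ] f
  Σ-*ˡ a f []       = sym (zeroʳ a)
  Σ-*ˡ a f (x ∷ xs) = trans (+-congˡ (Σ-*ˡ a f xs)) (sym (distribˡ a (f x) _))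

  Σ-*ʳ : ∀ {A : Set} a (f : A → Carrier) xs → Σ[ xs ] (λ x → f x * a) ≈ Σ[ xs ] f * a
  Σ-*ʳ a f xs = trans (Σ-cong xs (λ x → *-comm (f x) a)) (trans (Σ-*ˡ a f xs) (*-comm a _))

  Σ-++ : ∀ {A : Set} (f : A → Carrier) xs ys → Σ[ xs ++ ys ] f ≈ Σ[ xs ] f + Σ[ ys ] f
  Σ-++ f []       ys = sym (+-identityˡ _)
  Σ-++ f (x ∷ xs) ys = trans (+-congˡ (Σ-++ f xs ys)) (sym (+-assoc (f x) _ _))

  Σ-map : ∀ {A B : Set} (f : B → Carrier) (g : A → B) xs → Σ[ map g xs ] f ≈ Σ[ xs ] (f ∘ g)
  Σ-map f g xs = reflexive (foldr-map _ g 0# xs)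

  Σ-filter : ∀ {A : Set} {P : A → Set} (P? : Decidable P) (f : A → Carrier) xs →
             Σ[ filter P? xs ] f ≈ Σ[ xs ] (λ x → if does (P? x) then f x else 0#)
  Σ-filter P? f []       = refl
  Σ-filter P? f (x ∷ xs) with does (P? x)
  ... | true  = +-congˡ (Σ-filter P? f xs)
  ... | false = trans (Σ-filter P? f xs) (sym (+-identityˡ _))

  Σ-cartesianProductWith : ∀ {A B C : Set} (f : C → Carrier) (g : A → B → C) xs ys →
    Σ[ cartesianProductWith g xs ys ] f ≈ Σ[ xs ] (λ x → Σ[ ys ] (λ y → f (g x y)))
  Σ-cartesianProductWith f g []       ys = refl
  Σ-cartesianProductWith f g (x ∷ xs) ys =
    trans (Σ-++ f (map (g x) ys) _) (+-cong (Σ-map f (g x) ys) (Σ-cartesianProductWith f g xs ys))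

  Σ-suc : ∀ (f : ℕ → Carrier) n → Σ[ 0to (suc n) ] f ≈ f 0 + Σ[ 0to n ] (f ∘ suc)
  Σ-suc f n = +-congˡ (trans (reflexive (≡.cong (λ xs → Σ[ xs ] f) (≡.sym (map-upTo suc (suc n)))))
    (Σ-map f suc (upTo (suc n))))

  Σ-cong-≤ : ∀ {f g : ℕ → Carrier} n → (∀ i → i ℕ.≤ n → f i ≈ g i) → Σ[ 0to n ] f ≈ Σ[ 0to n ] g
  Σ-cong-≤ zero    f≈g = +-congʳ (f≈g 0 z≤n)
  Σ-cong-≤ {f} {g} (suc n) f≈g = trans (Σ-suc f n) (trans
    (+-cong (f≈g 0 z≤n) (Σ-cong-≤ n (λ i i≤n → f≈g (suc i) (s≤s i≤n)))) (sym (Σ-suc g n)))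

  product-cong : ∀ {n} {f g : Fin n → Carrier} → (∀ i → f i ≈ g i) → product f ≈ product g
  product-cong {zero}  f≈g = refl
  product-cong {suc n} f≈g = *-cong (f≈g zero) (product-cong (f≈g ∘ suc))

  -- Distributivity: a tuple picks one summand out of every factor. In `bell-power` this turns the
  -- sum over all index vectors into a product of exponential series.
  Σ-product : ∀ {A : Set} (xs : List A) n (f : Fin n → A → Carrier) →
    Σ[ tuples xs n ] (λ v → product (λ i → f i (lookup v i))) ≈ product (λ i → Σ[ xs ] (f i))
  Σ-product xs zero    f = +-identityʳ 1#
  Σ-product xs (suc n) f = begin
    Σ[ tuples xs (suc n) ] (λ v → product (λ i → f i (lookup v i)))
      ≈⟨ Σ-cartesianProductWith _ _∷_ xs (tuples xs n) ⟩
    Σ[ xs ] (λ x → Σ[ tuples xs n ] (λ v → f zero x * product (λ i → f (suc i) (lookup v i))))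
      ≈⟨ Σ-cong xs (λ x → trans (Σ-*ˡ (f zero x) _ (tuples xs n)) (*-congˡ (Σ-product xs n (f ∘ suc)))) ⟩
    Σ[ xs ] (λ x → f zero x * product (λ i → Σ[ xs ] (f (suc i))))
      ≈⟨ Σ-*ʳ _ (f zero) xs ⟩
    product (λ i → Σ[ xs ] (f i)) ∎

module PowerSeries {c ℓ : Level} (R : CommutativeSemiring c ℓ) where
  open CommutativeSemiring R hiding (zero)
  open Mult semiring using (_×_; ×-congʳ; ×-comm-*; ×-assocˡ; ×-idem)
  open CMMult +-commutativeMonoid using (×-distrib-+)
  open Sums R
  open Solver R using (solve; _:+_; _:*_; _:=_; con)
  open SetoidReasoning setoid

  infixl 7 _∗_
  -- The Cauchy product, computed by peeling off the constant term of the left factor rather than by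
  -- truncated subtraction; `⋆≈∗` identifies it with `_⋆_`.
  _∗_ : (ℕ → Carrier) → (ℕ → Carrier) → ℕ → Carrier
  (F ∗ G) zero    = F 0 * G 0
  (F ∗ G) (suc n) = F 0 * G (suc n) + ((F ∘ suc) ∗ G) n

  one : ℕ → Carrier
  one zero    = 1#
  one (suc _) = 0#

  -- The coefficient of degree n only involves degrees up to n of the factors. This is what permits
  -- truncated series later on.
  ∗-cong-≤ : ∀ {F F′ G G′} n → (∀ i → i ℕ.≤ n → F i ≈ F′ i) →
             (∀ i → i ℕ.≤ n → G i ≈ G′ i) → (F ∗ G) n ≈ (F′ ∗ G′) n
  ∗-cong-≤ zero    f g = *-cong (f 0 z≤n) (g 0 z≤n)
  ∗-cong-≤ (suc n) f g = +-cong (*-cong (f 0 z≤n) (g (suc n) ℕ.≤-refl))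
    (∗-cong-≤ n (λ i i≤n → f (suc i) (s≤s i≤n)) (λ i i≤n → g i (ℕ.m≤n⇒m≤1+n i≤n)))

  ∗-cong : ∀ {F F′ G G′} → (∀ i → F i ≈ F′ i) → (∀ i → G i ≈ G′ i) →
           ∀ n → (F ∗ G) n ≈ (F′ ∗ G′) n
  ∗-cong f g n = ∗-cong-≤ n (λ i _ → f i) (λ i _ → g i)

  ∗-distribʳ : ∀ H F G n → ((λ i → F i + G i) ∗ H) n ≈ (F ∗ H) n + (G ∗ H) n
  ∗-distribʳ H F G zero    = distribʳ (H 0) (F 0) (G 0)
  ∗-distribʳ H F G (suc n) = begin
    (F 0 + G 0) * H (suc n) + ((λ i → F (suc i) + G (suc i)) ∗ H) n
      ≈⟨ +-congˡ (∗-distribʳ H (F ∘ suc) (G ∘ suc) n) ⟩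
    (F 0 + G 0) * H (suc n) + (((F ∘ suc) ∗ H) n + ((G ∘ suc) ∗ H) n)
      ≈⟨ solve 5 (λ x y z v w → (x :+ y) :* z :+ (v :+ w) := x :* z :+ v :+ (y :* z :+ w))
           refl (F 0) (G 0) (H (suc n)) _ _ ⟩
    (F ∗ H) (suc n) + (G ∗ H) (suc n) ∎

  ∗-scaleˡ : ∀ x F G n → ((λ i → x * F i) ∗ G) n ≈ x * (F ∗ G) n
  ∗-scaleˡ x F G zero    = *-assoc x (F 0) (G 0)
  ∗-scaleˡ x F G (suc n) = begin
    x * F 0 * G (suc n) + ((λ i → x * F (suc i)) ∗ G) n
      ≈⟨ +-congˡ (∗-scaleˡ x (F ∘ suc) G n) ⟩
    x * F 0 * G (suc n) + x * ((F ∘ suc) ∗ G) n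
      ≈⟨ solve 4 (λ x y z w → x :* y :* z :+ x :* w := x :* (y :* z :+ w)) refl x (F 0) (G (suc n)) _ ⟩
    x * (F ∗ G) (suc n) ∎

  ∗-zeroˡ : ∀ G n → ((λ _ → 0#) ∗ G) n ≈ 0#
  ∗-zeroˡ G zero    = zeroˡ (G 0)
  ∗-zeroˡ G (suc n) = trans (+-cong (zeroˡ _) (∗-zeroˡ G n)) (+-identityˡ 0#)

  ∗-identityˡ : ∀ G n → (one ∗ G) n ≈ G n
  ∗-identityˡ G zero    = *-identityˡ (G 0)
  ∗-identityˡ G (suc n) = trans (+-cong (*-identityˡ _) (∗-zeroˡ G n)) (+-identityʳ _)

  -- `_∗_` peels its left factor only. Peeling first F and then G leaves the product of both tails
  -- two degrees lower, a core to which the induction hypothesis applies; hence the case of two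
  -- successors.
  ∗-comm : ∀ F G n → (F ∗ G) n ≈ (G ∗ F) n
  ∗-comm F G zero          = *-comm (F 0) (G 0)
  ∗-comm F G (suc zero)    = solve 4 (λ x y z w → x :* y :+ z :* w := w :* z :+ y :* x)
    refl (F 0) (G 1) (F 1) (G 0)
  ∗-comm F G (suc (suc n)) = begin
    F 0 * G (2 ℕ.+ n) + ((F ∘ suc) ∗ G) (suc n)
      ≈⟨ +-congˡ (∗-comm (F ∘ suc) G (suc n)) ⟩
    F 0 * G (2 ℕ.+ n) + (G 0 * F (2 ℕ.+ n) + ((G ∘ suc) ∗ (F ∘ suc)) n)
      ≈⟨ +-congˡ (+-congˡ (∗-comm (G ∘ suc) (F ∘ suc) n)) ⟩
    F 0 * G (2 ℕ.+ n) + (G 0 * F (2 ℕ.+ n) + ((F ∘ suc) ∗ (G ∘ suc)) n)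
      ≈⟨ solve 3 (λ x y z → x :+ (y :+ z) := y :+ (x :+ z)) refl _ _ _ ⟩
    G 0 * F (2 ℕ.+ n) + (F ∗ (G ∘ suc)) (suc n)
      ≈⟨ +-congˡ (∗-comm F (G ∘ suc) (suc n)) ⟩
    (G ∗ F) (2 ℕ.+ n) ∎

  ∗-assoc : ∀ F G H n → ((F ∗ G) ∗ H) n ≈ (F ∗ (G ∗ H)) n
  ∗-assoc F G H zero    = *-assoc (F 0) (G 0) (H 0)
  ∗-assoc F G H (suc n) = begin
    F 0 * G 0 * H (suc n) + ((λ i → F 0 * G (suc i) + ((F ∘ suc) ∗ G) i) ∗ H) n
      ≈⟨ +-congˡ (∗-distribʳ H (λ i → F 0 * G (suc i)) ((F ∘ suc) ∗ G) n) ⟩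
    F 0 * G 0 * H (suc n) + (((λ i → F 0 * G (suc i)) ∗ H) n + (((F ∘ suc) ∗ G) ∗ H) n)
      ≈⟨ +-congˡ (+-cong (∗-scaleˡ (F 0) (G ∘ suc) H n) (∗-assoc (F ∘ suc) G H n)) ⟩
    F 0 * G 0 * H (suc n) + (F 0 * ((G ∘ suc) ∗ H) n + ((F ∘ suc) ∗ (G ∗ H)) n)
      ≈⟨ solve 5 (λ x y z v w → x :* y :* z :+ (x :* v :+ w) := x :* (y :* z :+ v) :+ w)
           refl (F 0) (G 0) (H (suc n)) _ _ ⟩
    (F ∗ (G ∗ H)) (suc n) ∎

  -- Since series form a semiring again, the construction can be iterated: `S²` below consists of
  -- bivariate series, and the lemmas on sums apply to series too.
  commutativeSemiring : CommutativeSemiring c ℓ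
  commutativeSemiring = record
    { Carrier = ℕ → Carrier
    ; _≈_ = λ F G → ∀ n → F n ≈ G n
    ; _+_ = λ F G n → F n + G n
    ; _*_ = _∗_
    ; 0# = λ _ → 0#
    ; 1# = one
    ; isCommutativeSemiring = isCommutativeSemiringˡ (record
      { +-isCommutativeMonoid = Pointwise.isCommutativeMonoid ℕ +-isCommutativeMonoid
      ; *-isCommutativeMonoid = record
        { isMonoid = record
          { isSemigroup = record
            { isMagma = record
              { isEquivalence = Pointwise.isEquivalence ℕ isEquivalence
              ; ∙-cong = ∗-cong }
            ; assoc = ∗-assoc }
          ; identity = ∗-identityˡ , λ G n → trans (∗-comm G one n) (∗-identityˡ G n) }
        ; comm = ∗-comm }
      ; distribʳ = ∗-distribʳ
      ; zeroˡ = ∗-zeroˡ }) }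

  ∗-scaleʳ : ∀ x F G n → (F ∗ (λ i → x * G i)) n ≈ x * (F ∗ G) n
  ∗-scaleʳ x F G n = trans (∗-comm F _ n) (trans (∗-scaleˡ x G F n) (*-congˡ (∗-comm G F n)))

  private
    module S = CommutativeSemiring commutativeSemiring
    module SM = Mult S.semiring

  open Exp S.semiring public using () renaming (_^_ to _^∗_)

  ^∗-cong-≤ : ∀ {F G} r n → (∀ i → i ℕ.≤ n → F i ≈ G i) → (F ^∗ r) n ≈ (G ^∗ r) n
  ^∗-cong-≤ zero    n f = refl
  ^∗-cong-≤ (suc r) n f = ∗-cong-≤ n f
    (λ i i≤n → ^∗-cong-≤ r i (λ k k≤i → f k (ℕ.≤-trans k≤i i≤n)))

  ×-pointwise : ∀ k F n → (k SM.× F) n ≈ k × F n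
  ×-pointwise zero    F n = refl
  ×-pointwise (suc k) F n = +-congˡ (×-pointwise k F n)

  private
    ×-zeroʳ : ∀ n → n × 0# ≈ 0#
    ×-zeroʳ zero    = refl
    ×-zeroʳ (suc n) = ×-idem (+-identityˡ 0#) (suc n)

  -- The Euler operator x d/dx

  ϑ : (ℕ → Carrier) → ℕ → Carrier
  ϑ F n = n × F n

  -- Leibniz rule. Because of the index shift, the tail of `ϑ F` is `F ∘ suc` plus `ϑ (F ∘ suc)`;
  -- the additional copy `FG` accounts for the first of these.
  ϑ-∗ : ∀ F G n → ϑ (F ∗ G) n ≈ (ϑ F ∗ G) n + (F ∗ ϑ G) n
  ϑ-∗ F G zero    = solve 2 (λ x y → con 0 := con 0 :* y :+ x :* con 0) refl (F 0) (G 0)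
  ϑ-∗ F G (suc n) = begin
    suc n × (F 0 * G (suc n) + FG)
      ≈⟨ ×-distrib-+ _ _ (suc n) ⟩
    suc n × (F 0 * G (suc n)) + (FG + ϑ ((F ∘ suc) ∗ G) n)
      ≈⟨ +-cong (sym (×-comm-* (suc n) (F 0) _)) (+-congˡ (ϑ-∗ (F ∘ suc) G n)) ⟩
    F 0 * ϑ G (suc n) + (FG + ((ϑ (F ∘ suc) ∗ G) n + ((F ∘ suc) ∗ ϑ G) n))
      ≈⟨ solve 5 (λ x a b c g → x :+ (a :+ (b :+ c)) := con 0 :* g :+ (a :+ b) :+ (x :+ c))
           refl _ FG _ _ (G (suc n)) ⟩
    0# * G (suc n) + (FG + (ϑ (F ∘ suc) ∗ G) n) + (F ∗ ϑ G) (suc n)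
      ≈⟨ +-congʳ (+-congˡ (∗-distribʳ G (F ∘ suc) (ϑ (F ∘ suc)) n)) ⟨
    (ϑ F ∗ G) (suc n) + (F ∗ ϑ G) (suc n) ∎
    where
    FG = ((F ∘ suc) ∗ G) n

  -- Power rule x (Fʳ⁺¹)′ = (r + 1) x F′ Fʳ, by induction from the Leibniz rule. `cycle` uses it to
  -- evaluate Σ a tₐ [xᵏ⁻ᵃ] Tᴺ.
  ϑ-^∗ : ∀ F r n → ϑ (F ^∗ suc r) n ≈ suc r × (ϑ F ∗ F ^∗ r) n
  ϑ-^∗ F zero n = begin
    ϑ (F ∗ one) n               ≈⟨ ϑ-∗ F one n ⟩
    (ϑ F ∗ one) n + (F ∗ ϑ one) n ≈⟨ +-congˡ (S.*-congˡ {F} ϑ-one n) ⟩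
    (ϑ F ∗ one) n + (F ∗ (λ _ → 0#)) n ≈⟨ +-congˡ (S.zeroʳ F n) ⟩
    1 × (ϑ F ∗ one) n           ∎
    where
    ϑ-one : ∀ n → ϑ one n ≈ 0#
    ϑ-one zero    = refl
    ϑ-one (suc n) = ×-zeroʳ (suc n)
  ϑ-^∗ F (suc r) n = begin
    ϑ (F ∗ F ^∗ suc r) n
      ≈⟨ ϑ-∗ F (F ^∗ suc r) n ⟩
    (ϑ F ∗ F ^∗ suc r) n + (F ∗ ϑ (F ^∗ suc r)) n
      ≈⟨ +-congˡ (S.*-congˡ {F} step n) ⟩
    (ϑ F ∗ F ^∗ suc r) n + (F ∗ (suc r SM.× (ϑ F ∗ F ^∗ r))) n
      ≈⟨ +-congˡ (SM.×-comm-* (suc r) F _ n) ⟩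
    (ϑ F ∗ F ^∗ suc r) n + (suc r SM.× (F ∗ (ϑ F ∗ F ^∗ r))) n
      ≈⟨ +-congˡ (SM.×-congʳ (suc r) (swap F (ϑ F) (F ^∗ r)) n) ⟩
    (ϑ F ∗ F ^∗ suc r) n + (suc r SM.× (ϑ F ∗ F ^∗ suc r)) n
      ≈⟨ +-congˡ (×-pointwise (suc r) _ n) ⟩
    suc (suc r) × (ϑ F ∗ F ^∗ suc r) n ∎
    where
    step : ∀ n → ϑ (F ^∗ suc r) n ≈ (suc r SM.× (ϑ F ∗ F ^∗ r)) n
    step n = trans (ϑ-^∗ F r n) (sym (×-pointwise (suc r) _ n))
    swap : ∀ X Y Z n → (X ∗ (Y ∗ Z)) n ≈ (Y ∗ (X ∗ Z)) n
    swap X Y Z n = trans (sym (∗-assoc X Y Z n))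
      (trans (S.*-congʳ {Z} (∗-comm X Y) n) (∗-assoc Y X Z n))

  -- Monomials and exponential series

  monomial : Carrier → ℕ → ℕ → Carrier
  monomial x zero    zero    = x
  monomial x zero    (suc n) = 0#
  monomial x (suc e) zero    = 0#
  monomial x (suc e) (suc n) = monomial x e n

  monomial-cong : ∀ {x y} → x ≈ y → ∀ e n → monomial x e n ≈ monomial y e n
  monomial-cong x≈y zero    zero    = x≈y
  monomial-cong x≈y zero    (suc n) = refl
  monomial-cong x≈y (suc e) zero    = refl
  monomial-cong x≈y (suc e) (suc n) = monomial-cong x≈y e n

  monomial-* : ∀ x y e e′ n →
               (monomial x e ∗ monomial y e′) n ≈ monomial (x * y) (e ℕ.+ e′) n
  monomial-* x y zero e′ n = trans (constant n) (scale e′ n)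
    where
    constant : ∀ {G} n → (monomial x 0 ∗ G) n ≈ x * G n
    constant     zero    = refl
    constant {G} (suc n) = trans (+-congˡ (∗-zeroˡ G n)) (+-identityʳ _)
    scale : ∀ e n → x * monomial y e n ≈ monomial (x * y) e n
    scale zero    zero    = refl
    scale zero    (suc n) = zeroʳ x
    scale (suc e) zero    = zeroʳ x
    scale (suc e) (suc n) = scale e n
  monomial-* x y (suc e) e′ zero    = zeroˡ _
  monomial-* x y (suc e) e′ (suc n) = trans (+-cong (zeroˡ _) (monomial-* x y e e′ n)) (+-identityˡ _)

  ×-monomial : ∀ k x e n → k × monomial x e n ≈ monomial (k × x) e n
  ×-monomial k x zero    zero    = refl
  ×-monomial k x zero    (suc n) = ×-zeroʳ k
  ×-monomial k x (suc e) zero    = ×-zeroʳ k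
  ×-monomial k x (suc e) (suc n) = ×-monomial k x e n

  monomial-≡ᵇ : ∀ x e n → monomial x e n ≈ (if e ℕ.≡ᵇ n then x else 0#)
  monomial-≡ᵇ x zero    zero    = refl
  monomial-≡ᵇ x zero    (suc n) = refl
  monomial-≡ᵇ x (suc e) zero    = refl
  monomial-≡ᵇ x (suc e) (suc n) = monomial-≡ᵇ x e n

  -- At degree n only the summand s = n survives, and it occurs since n ≤ b.
  Σ-monomial : ∀ (F : ℕ → Carrier) b n → n ℕ.≤ b → Σ[ 0to b ] (λ s → monomial (F s) s n) ≈ F n
  Σ-monomial F zero    zero    _         = +-identityʳ (F 0)
  Σ-monomial F (suc b) zero    _         =
    trans (Σ-suc _ b) (trans (+-congˡ (Σ-zero (0to b))) (+-identityʳ (F 0)))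
  Σ-monomial F (suc b) (suc n) (s≤s n≤b) =
    trans (Σ-suc _ b) (trans (+-identityˡ _) (Σ-monomial (F ∘ suc) b n n≤b))

  open Sums commutativeSemiring public using () renaming (Σ[_] to Σ∗[_]; sum to sum∗; product to product∗)

  Σ-pointwise : ∀ {A : Set} (f : A → ℕ → Carrier) xs n → Σ∗[ xs ] f n ≈ Σ[ xs ] (λ x → f x n)
  Σ-pointwise f []       n = refl
  Σ-pointwise f (x ∷ xs) n = +-congˡ (Σ-pointwise f xs n)

  Σ∗-monomial : ∀ (F : ℕ → Carrier) b n → n ℕ.≤ b → Σ∗[ 0to b ] (λ s → monomial (F s) s) n ≈ F n
  Σ∗-monomial F b n n≤b = trans (Σ-pointwise _ (0to b) n) (Σ-monomial F b n n≤b)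

  sum-monomial-0 : ∀ b (G : Fin b → Carrier) (e : Fin b → ℕ) →
                   sum∗ (λ i → monomial (G i) (suc (e i))) 0 ≈ 0#
  sum-monomial-0 zero    G e = refl
  sum-monomial-0 (suc b) G e = trans (+-identityˡ _) (sum-monomial-0 b (G ∘ suc) (e ∘ suc))

  sum-monomial-suc : ∀ b (G : Fin b → Carrier) (e : Fin b → ℕ) n →
    sum∗ (λ i → monomial (G i) (suc (e i))) (suc n) ≈ sum∗ (λ i → monomial (G i) (e i)) n
  sum-monomial-suc zero    G e n = refl
  sum-monomial-suc (suc b) G e n = +-congˡ (sum-monomial-suc b (G ∘ suc) (e ∘ suc) n)

  sum-monomial : ∀ (F : ℕ → Carrier) b n → n ℕ.< b →
    sum∗ {b} (λ i → monomial (F (toℕ i)) (toℕ i)) n ≈ F n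
  sum-monomial F (suc b) zero    _         =
    trans (+-congˡ (sum-monomial-0 b (F ∘ suc ∘ toℕ) toℕ)) (+-identityʳ (F 0))
  sum-monomial F (suc b) (suc n) (s≤s n<b) = trans (+-identityˡ _)
    (trans (sum-monomial-suc b (F ∘ suc ∘ toℕ) toℕ n) (sum-monomial (F ∘ suc) b n n<b))

  product∗-cong-≤ : ∀ {k} {F G : Fin k → ℕ → Carrier} n → (∀ i j → j ℕ.≤ n → F i j ≈ G i j) →
                    product∗ F n ≈ product∗ G n
  product∗-cong-≤ {zero}  n F≈G = refl
  product∗-cong-≤ {suc k} n F≈G = ∗-cong-≤ n (F≈G zero)
    (λ j j≤n → product∗-cong-≤ j (λ i l l≤j → F≈G (suc i) l (ℕ.≤-trans l≤j j≤n)))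

  -- E = exp (a z), pinned down by E(0) = 1 and E′ = a E. In this form the notion makes sense over
  -- any commutative semiring, in particular over series.
  record IsExp (a : Carrier) (E : ℕ → Carrier) : Set ℓ where
    field
      initial    : E 0 ≈ 1#
      derivative : ∀ r → suc r × E (suc r) ≈ a * E r

  open IsExp public

  IsExp-one : IsExp 0# one
  IsExp-one .initial      = refl
  IsExp-one .derivative r = trans (×-zeroʳ (suc r)) (sym (zeroˡ _))

  -- exp (a z) exp (b z) = exp ((a + b) z), since the product rule gives (E F)′ = a E F + b E F.
  IsExp-∗ : ∀ {a b E F} → IsExp a E → IsExp b F → IsExp (a + b) (E ∗ F)
  IsExp-∗ e f .initial = trans (*-cong (e .initial) (f .initial)) (*-identityˡ 1#)
  IsExp-∗ {a} {b} {E} {F} e f .derivative r = begin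
    ϑ (E ∗ F) (suc r)
      ≈⟨ ϑ-∗ E F (suc r) ⟩
    (ϑ E ∗ F) (suc r) + (E ∗ ϑ F) (suc r)
      ≈⟨ +-cong (half e F) (trans (∗-comm E (ϑ F) (suc r)) (half f E)) ⟩
    a * (E ∗ F) r + b * (F ∗ E) r
      ≈⟨ +-congˡ (*-congˡ (∗-comm F E r)) ⟩
    a * (E ∗ F) r + b * (E ∗ F) r
      ≈⟨ distribʳ _ a b ⟨
    (a + b) * (E ∗ F) r ∎
    where
    -- `ϑ E` is z E′: its constant term vanishes and its tail is a E.
    half : ∀ {a E} → IsExp a E → ∀ F → (ϑ E ∗ F) (suc r) ≈ a * (E ∗ F) r
    half {a} {E} e F = begin
      0# * F (suc r) + ((ϑ E ∘ suc) ∗ F) r ≈⟨ +-cong (zeroˡ _) (∗-cong (e .derivative) (λ _ → refl) r) ⟩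
      0# + ((λ i → a * E i) ∗ F) r         ≈⟨ +-identityˡ _ ⟩
      ((λ i → a * E i) ∗ F) r              ≈⟨ ∗-scaleˡ a E F r ⟩
      a * (E ∗ F) r                        ∎

  IsExp-product : ∀ {n} (a : Fin n → Carrier) (E : Fin n → ℕ → Carrier) →
                  (∀ i → IsExp (a i) (E i)) → IsExp (sum a) (product∗ E)
  IsExp-product {zero}  a E e = IsExp-one
  IsExp-product {suc n} a E e = IsExp-∗ (e zero) (IsExp-product (a ∘ suc) (E ∘ suc) (e ∘ suc))

  open Exp semiring using (_^_)

  -- The r-th derivative of exp (a z) at 0, obtained by r uses of E′ = a E.
  exp-power : ∀ {a E} → IsExp a E → ∀ r → (r !) × E r ≈ a ^ r
  exp-power e zero = trans (+-identityʳ _) (e .initial)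
  exp-power {a} {E} e (suc r) = begin
    (suc r ℕ.* r !) × E (suc r)   ≡⟨ ≡.cong (_× E (suc r)) (ℕ.*-comm (suc r) (r !)) ⟩
    (r ! ℕ.* suc r) × E (suc r)   ≈⟨ ×-assocˡ _ (r !) (suc r) ⟨
    (r !) × (suc r × E (suc r))   ≈⟨ ×-congʳ (r !) (e .derivative r) ⟩
    (r !) × (a * E r)             ≈⟨ ×-comm-* (r !) a (E r) ⟨
    a * (r !) × E r               ≈⟨ *-congˡ (exp-power e r) ⟩
    a ^ suc r                     ∎

-- Rational coefficients

fromℤ : ℤ → ℚ
fromℤ i = i ℚ./ 1

-- Rationals are kept in lowest terms, which blocks computation with variables. Identities are
-- therefore checked on unnormalised fractions, as integer equations, and carried over by `fromℚᵘ`.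
fromℚᵘ-+ : ∀ p q → ℚ.fromℚᵘ p ℚ.+ ℚ.fromℚᵘ q ≡ ℚ.fromℚᵘ (p ℚᵘ.+ q)
fromℚᵘ-+ p q = ℚ.toℚᵘ-injective (ℚᵘ.≃-trans (ℚ.toℚᵘ-homo-+ (ℚ.fromℚᵘ p) (ℚ.fromℚᵘ q))
  (ℚᵘ.≃-trans (ℚᵘ.+-cong (ℚ.toℚᵘ-fromℚᵘ p) (ℚ.toℚᵘ-fromℚᵘ q)) (ℚᵘ.≃-sym (ℚ.toℚᵘ-fromℚᵘ (p ℚᵘ.+ q)))))

fromℚᵘ-* : ∀ p q → ℚ.fromℚᵘ p ℚ.* ℚ.fromℚᵘ q ≡ ℚ.fromℚᵘ (p ℚᵘ.* q)
fromℚᵘ-* p q = ℚ.toℚᵘ-injective (ℚᵘ.≃-trans (ℚ.toℚᵘ-homo-* (ℚ.fromℚᵘ p) (ℚ.fromℚᵘ q))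
  (ℚᵘ.≃-trans (ℚᵘ.*-cong (ℚ.toℚᵘ-fromℚᵘ p) (ℚ.toℚᵘ-fromℚᵘ q)) (ℚᵘ.≃-sym (ℚ.toℚᵘ-fromℚᵘ (p ℚᵘ.* q)))))

fromℤ-+ : ∀ i j → fromℤ (i ℤ.+ j) ≡ fromℤ i ℚ.+ fromℤ j
fromℤ-+ i j = ≡.sym (≡.trans (fromℚᵘ-+ (ℚᵘ.mkℚᵘ i 0) (ℚᵘ.mkℚᵘ j 0))
  (ℚ.fromℚᵘ-cong {ℚᵘ.mkℚᵘ i 0 ℚᵘ.+ ℚᵘ.mkℚᵘ j 0} {ℚᵘ.mkℚᵘ (i ℤ.+ j) 0}
    (ℚᵘ.*≡* (≡.cong (ℤ._* + 1) (≡.cong₂ ℤ._+_ (ℤ.*-identityʳ i) (ℤ.*-identityʳ j))))))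

fromℤ-* : ∀ i j → fromℤ (i ℤ.* j) ≡ fromℤ i ℚ.* fromℤ j
fromℤ-* i j = ≡.sym (fromℚᵘ-* (ℚᵘ.mkℚᵘ i 0) (ℚᵘ.mkℚᵘ j 0))

fromℕ-+ : ∀ m n → fromℕ (m ℕ.+ n) ≡ fromℕ m ℚ.+ fromℕ n
fromℕ-+ m n = fromℤ-+ (+ m) (+ n)

fromℕ-* : ∀ m n → fromℕ (m ℕ.* n) ≡ fromℕ m ℚ.* fromℕ n
fromℕ-* m n = ≡.trans (≡.cong fromℤ (ℤ.pos-* m n)) (fromℤ-* (+ m) (+ n))

inv : (n : ℕ) .{{_ : NonZero n}} → ℚ
inv n = + 1 ℚ./ n

-- Separating the numerator from 1 / n lets the ring solver treat `inv n` as an atom.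
/-inv : ∀ i n .{{_ : NonZero n}} → i ℚ./ n ≡ fromℤ i ℚ.* inv n
/-inv i (suc n) = ≡.sym (≡.trans (fromℚᵘ-* (ℚᵘ.mkℚᵘ i 0) (ℚᵘ.mkℚᵘ (+ 1) n))
  (ℚ.fromℚᵘ-cong {ℚᵘ.mkℚᵘ i 0 ℚᵘ.* ℚᵘ.mkℚᵘ (+ 1) n} {ℚᵘ.mkℚᵘ i n}
    (ℚᵘ.*≡* (≡.trans (≡.cong (ℤ._* + suc n) (ℤ.*-identityʳ i))
                     (≡.cong (λ k → i ℤ.* + suc k) (≡.sym (ℕ.+-identityʳ n)))))))

fromℕ-inv : ∀ n .{{_ : NonZero n}} → fromℕ n ℚ.* inv n ≡ 1ℚ
fromℕ-inv (suc n) = ≡.trans (≡.sym (/-inv (+ suc n) (suc n)))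
  (ℚ.fromℚᵘ-cong {ℚᵘ.mkℚᵘ (+ suc n) n} {ℚᵘ.1ℚᵘ}
    (ℚᵘ.*≡* (≡.trans (ℤ.*-identityʳ (+ suc n)) (≡.sym (ℤ.*-identityˡ (+ suc n))))))

inv-* : ∀ m n .{{m≢0 : NonZero m}} .{{n≢0 : NonZero n}} →
        inv (m ℕ.* n) {{ℕ.m*n≢0 m n}} ≡ inv m ℚ.* inv n
inv-* (suc m) (suc n) = ≡.sym (fromℚᵘ-* (ℚᵘ.mkℚᵘ (+ 1) m) (ℚᵘ.mkℚᵘ (+ 1) n))

-- Binomial identities and the coefficients of the cycle lemma

C-absorption : ∀ n k → suc n ℕ.* (n C k) ≡ suc k ℕ.* (suc n C suc k)
C-absorption n       zero    = ≡.trans (ℕ.*-identityʳ (suc n))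
  (≡.trans (≡.sym (nC1≡n (suc n))) (≡.sym (ℕ.+-identityʳ (suc n C 1))))
C-absorption zero    (suc k) =
  ≡.trans (≡.cong (λ c → c ℕ.+ 0) (k>n⇒nCk≡0 {0} {suc k} (s≤s z≤n)))
  (≡.sym (≡.trans (≡.cong ((2 ℕ.+ k) ℕ.*_) (k>n⇒nCk≡0 {1} {2 ℕ.+ k} (s≤s (s≤s z≤n)))) (ℕ.*-zeroʳ (2 ℕ.+ k))))
C-absorption (suc n) (suc k) = ≡.sym (begin
  (2 ℕ.+ k) ℕ.* ((2 ℕ.+ n) C (2 ℕ.+ k))
    ≡⟨ ≡.cong ((2 ℕ.+ k) ℕ.*_) (nCk+nC[k+1]≡[n+1]C[k+1] (suc n) (suc k)) ⟨
  (2 ℕ.+ k) ℕ.* (x ℕ.+ suc n C (2 ℕ.+ k))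
    -- Splitting off one copy of x leaves the right sides of both induction hypotheses, whose left
    -- sides sum to (n + 1) x by Pascal's rule.
    ≡⟨ solve 3 (λ k x y → (con 2 :+ k) :* (x :+ y) := x :+ ((con 1 :+ k) :* x :+ (con 2 :+ k) :* y))
         ≡.refl k x _ ⟩
  x ℕ.+ (suc k ℕ.* x ℕ.+ (2 ℕ.+ k) ℕ.* (suc n C (2 ℕ.+ k)))
    ≡⟨ ≡.cong (x ℕ.+_) (≡.cong₂ ℕ._+_ (C-absorption n k) (C-absorption n (suc k))) ⟨
  x ℕ.+ (suc n ℕ.* (n C k) ℕ.+ suc n ℕ.* (n C suc k))
    ≡⟨ ≡.cong (x ℕ.+_) (ℕ.*-distribˡ-+ (suc n) (n C k) (n C suc k)) ⟨
  x ℕ.+ suc n ℕ.* (n C k ℕ.+ n C suc k)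
    ≡⟨ ≡.cong (λ y → x ℕ.+ suc n ℕ.* y) (nCk+nC[k+1]≡[n+1]C[k+1] n k) ⟩
  (2 ℕ.+ n) ℕ.* x ∎)
  where
  open ≡.≡-Reasoning
  open +-*-Solver using (solve; con; _:+_; _:*_; _:=_)
  x = suc n C suc k

-- Adding j C(m + j, j - 1) to both sides makes each of them (m + j + 1) C(m + j, j - 1), by
-- absorption and Pascal's rule. For j = 0 both sides vanish, the left one by the convention on
-- negative lower indices.
binomial-pred : ∀ m j → fromℕ (suc m) ℚ.* binomial (m ℕ.+ j) (+ j ℤ.- + 1)
                      ≡ fromℕ j ℚ.* binomial (m ℕ.+ j) (+ j)
binomial-pred m zero    = ≡.trans (ℚ.*-zeroʳ (fromℕ (suc m))) (≡.sym (ℚ.*-zeroˡ (binomial (m ℕ.+ 0) (+ 0))))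
binomial-pred m (suc j) = ≡.trans (≡.sym (fromℕ-* (suc m) (n C j)))
  (≡.trans (≡.cong fromℕ
    (ℕ.+-cancelʳ-≡ (suc j ℕ.* (n C j)) (suc m ℕ.* (n C j)) (suc j ℕ.* (n C suc j)) shifted))
  (fromℕ-* (suc j) (n C suc j)))
  where
  open +-*-Solver using (solve; con; _:+_; _:*_; _:=_)
  n = m ℕ.+ suc j
  shifted : suc m ℕ.* (n C j) ℕ.+ suc j ℕ.* (n C j) ≡ suc j ℕ.* (n C suc j) ℕ.+ suc j ℕ.* (n C j)
  shifted = ≡.trans (≡.sym (ℕ.*-distribʳ-+ (n C j) (suc m) (suc j)))
    (≡.trans (C-absorption n j)
    (≡.trans (≡.cong (suc j ℕ.*_) (≡.sym (nCk+nC[k+1]≡[n+1]C[k+1] n j)))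
    (solve 3 (λ j x y → j :* (x :+ y) := j :* y :+ j :* x) ≡.refl (suc j) (n C j) (n C suc j))))

-- The first block brings a path at height z to z - 1 (ending in d) or leaves it
-- there (ending in h); the cycle lemma counts both continuations.
cycleCoefficient : (n : ℕ) .{{_ : NonZero n}} → ℕ → ℤ → ℚ
cycleCoefficient n j z = (z ℚ./ n) ℚ.* binomial n (+ j) ℚ.+ ((z ℤ.+ + 1) ℚ./ n) ℚ.* binomial n (+ j ℤ.- + 1)

module _ where
  open ≡.≡-Reasoning
  open ℚSolver.+-*-Solver using (solve; con; _:+_; _:*_; _:=_)

  cycleCoefficient-inv : ∀ n .{{_ : NonZero n}} j z → cycleCoefficient n j z ≡
    fromℤ z ℚ.* inv n ℚ.* binomial n (+ j) ℚ.+ (fromℤ z ℚ.+ 1ℚ) ℚ.* inv n ℚ.* binomial n (+ j ℤ.- + 1)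
  cycleCoefficient-inv n j z = ≡.cong₂ ℚ._+_
    (≡.cong (ℚ._* binomial n (+ j)) (/-inv z n))
    (≡.cong (ℚ._* binomial n (+ j ℤ.- + 1)) (≡.trans (/-inv (z ℤ.+ + 1) n)
      (≡.cong (ℚ._* inv n) (fromℤ-+ z (+ 1)))))

  binomial-pascal : ∀ n j → binomial n (+ j) ℚ.+ binomial n (+ j ℤ.- + 1) ≡ binomial (suc n) (+ j)
  binomial-pascal n zero    = ≡.refl
  binomial-pascal n (suc j) = ≡.trans (≡.sym (fromℕ-+ (n C suc j) (n C j)))
    (≡.cong fromℕ {n C suc j ℕ.+ n C j} {suc n C suc j}
      (≡.trans (ℕ.+-comm (n C suc j) (n C j)) (nCk+nC[k+1]≡[n+1]C[k+1] n j)))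

  binomial-absorption : ∀ n j →
    fromℕ (suc n) ℚ.* binomial n (+ j ℤ.- + 1) ≡ fromℕ j ℚ.* binomial (suc n) (+ j)
  binomial-absorption n zero    =
    ≡.trans (ℚ.*-zeroʳ (fromℕ (suc n))) (≡.sym (ℚ.*-zeroˡ (binomial (suc n) (+ 0))))
  binomial-absorption n (suc j) = ≡.trans (≡.sym (fromℕ-* (suc n) (n C j)))
    (≡.trans (≡.cong fromℕ {suc n ℕ.* (n C j)} {suc j ℕ.* (suc n C suc j)} (C-absorption n j))
             (fromℕ-* (suc j) (suc n C suc j)))

  solveʳ : ∀ n .{{_ : NonZero n}} x y → fromℕ n ℚ.* x ≡ y → x ≡ inv n ℚ.* y
  solveʳ n x y eq = begin
    x                          ≡⟨ ℚ.*-identityˡ x ⟨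
    1ℚ ℚ.* x                   ≡⟨ ≡.cong (ℚ._* x) (fromℕ-inv n) ⟨
    fromℕ n ℚ.* inv n ℚ.* x    ≡⟨
      solve 3 (λ a b c → a :* b :* c := b :* (a :* c)) ≡.refl (fromℕ n) (inv n) x ⟩
    inv n ℚ.* (fromℕ n ℚ.* x)  ≡⟨ ≡.cong (inv n ℚ.*_) eq ⟩
    inv n ℚ.* y                ∎

  -- By `binomial-pred` the second binomial coefficient is j / (m + 1) times the first; expanding
  -- the first summand by (m + 1) / (m + 1) gives both the same denominator.
  cycleCoefficient-bell : ∀ m j .{{m+j≢0 : NonZero (m ℕ.+ j)}} .{{den≢0 : NonZero (suc m ℕ.* (m ℕ.+ j))}} z →
    cycleCoefficient (m ℕ.+ j) j z ≡
    binomial (m ℕ.+ j) (+ j) ℚ.* ((+ suc m ℤ.* z ℤ.+ + j ℤ.* (z ℤ.+ + 1)) ℚ./ (suc m ℕ.* (m ℕ.+ j)))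
  cycleCoefficient-bell m j z = begin
    cycleCoefficient N j z
      ≡⟨ cycleCoefficient-inv N j z ⟩
    Z ℚ.* I ℚ.* c ℚ.+ (Z ℚ.+ 1ℚ) ℚ.* I ℚ.* binomial N (+ j ℤ.- + 1)
      ≡⟨ ≡.cong₂ (λ v w → v ℚ.+ (Z ℚ.+ 1ℚ) ℚ.* I ℚ.* w)
           (≡.trans (≡.sym (ℚ.*-identityˡ (Z ℚ.* I ℚ.* c)))
                     (≡.cong (ℚ._* (Z ℚ.* I ℚ.* c)) (≡.sym (fromℕ-inv (suc m)))))
           (solveʳ (suc m) (binomial N (+ j ℤ.- + 1)) (fromℕ j ℚ.* c) (binomial-pred m j)) ⟩
    fromℕ (suc m) ℚ.* inv (suc m) ℚ.* (Z ℚ.* I ℚ.* c)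
    ℚ.+ (Z ℚ.+ 1ℚ) ℚ.* I ℚ.* (inv (suc m) ℚ.* (fromℕ j ℚ.* c))
      ≡⟨ solve 6 (λ Z I c J M I′ → M :* I′ :* (Z :* I :* c) :+ (Z :+ con 1ℚ) :* I :* (I′ :* (J :* c))
                    := c :* ((M :* Z :+ J :* (Z :+ con 1ℚ)) :* (I′ :* I)))
           ≡.refl Z I c (fromℕ j) (fromℕ (suc m)) (inv (suc m)) ⟩
    c ℚ.* ((fromℕ (suc m) ℚ.* Z ℚ.+ fromℕ j ℚ.* (Z ℚ.+ 1ℚ)) ℚ.* (inv (suc m) ℚ.* I))
      ≡⟨ ≡.cong (c ℚ.*_) (≡.cong₂ ℚ._*_ numerator (inv-* (suc m) N)) ⟨
    c ℚ.* (fromℤ num ℚ.* inv (suc m ℕ.* N))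
      ≡⟨ ≡.cong (c ℚ.*_) (/-inv num (suc m ℕ.* N)) ⟨
    c ℚ.* (num ℚ./ (suc m ℕ.* N)) ∎
    where
    N = m ℕ.+ j
    Z = fromℤ z
    I = inv N
    c = binomial N (+ j)
    num = + suc m ℤ.* z ℤ.+ + j ℤ.* (z ℤ.+ + 1)
    numerator : fromℤ num ≡ fromℕ (suc m) ℚ.* Z ℚ.+ fromℕ j ℚ.* (Z ℚ.+ 1ℚ)
    numerator = ≡.trans (fromℤ-+ (+ suc m ℤ.* z) (+ j ℤ.* (z ℤ.+ + 1)))
      (≡.cong₂ ℚ._+_ (fromℤ-* (+ suc m) z)
        (≡.trans (fromℤ-* (+ j) (z ℤ.+ + 1)) (≡.cong (fromℕ j ℚ.*_) (fromℤ-+ z (+ 1)))))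

  -- The coefficient is affine in the height, with slope C(n + 1, j) / n by Pascal's rule. The
  -- length a of the first u-segment hence enters linearly, as in `ϑ t`.
  cycleCoefficient-+ : ∀ n .{{_ : NonZero n}} j y a → cycleCoefficient n j (+ (y ℕ.+ a)) ≡
    cycleCoefficient n j (+ y) ℚ.+ (inv n ℚ.* binomial (suc n) (+ j)) ℚ.* fromℕ a
  cycleCoefficient-+ n j y a = begin
    cycleCoefficient n j (+ (y ℕ.+ a))
      ≡⟨ cycleCoefficient-inv n j (+ (y ℕ.+ a)) ⟩
    fromℕ (y ℕ.+ a) ℚ.* I ℚ.* c ℚ.+ (fromℕ (y ℕ.+ a) ℚ.+ 1ℚ) ℚ.* I ℚ.* c′
      ≡⟨ ≡.cong (λ x → x ℚ.* I ℚ.* c ℚ.+ (x ℚ.+ 1ℚ) ℚ.* I ℚ.* c′) (fromℕ-+ y a) ⟩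
    (Y ℚ.+ A) ℚ.* I ℚ.* c ℚ.+ (Y ℚ.+ A ℚ.+ 1ℚ) ℚ.* I ℚ.* c′
      ≡⟨ solve 5 (λ Y A I c c′ → (Y :+ A) :* I :* c :+ (Y :+ A :+ con 1ℚ) :* I :* c′
                    := (Y :* I :* c :+ (Y :+ con 1ℚ) :* I :* c′) :+ (I :* (c :+ c′)) :* A)
           ≡.refl Y A I c c′ ⟩
    (Y ℚ.* I ℚ.* c ℚ.+ (Y ℚ.+ 1ℚ) ℚ.* I ℚ.* c′) ℚ.+ (I ℚ.* (c ℚ.+ c′)) ℚ.* A
      ≡⟨ ≡.cong₂ (λ v w → v ℚ.+ (I ℚ.* w) ℚ.* A) (≡.sym (cycleCoefficient-inv n j (+ y)))
                                                    (binomial-pascal n j) ⟩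
    cycleCoefficient n j (+ y) ℚ.+ (I ℚ.* binomial (suc n) (+ j)) ℚ.* A ∎
    where
    Y = fromℕ y
    A = fromℕ a
    I = inv n
    c = binomial n (+ j)
    c′ = binomial n (+ j ℤ.- + 1)

  -- Put B = C(n + 1, j). By Pascal's rule and absorption everything is a multiple of B / (n (n +
  -- 1)); the numerator on the left is y (n + 1) + j + k = n (y + 1), because y + k + j = n.
  cycleCoefficient-step : ∀ y k j .{{_ : NonZero (y ℕ.+ k ℕ.+ j)}} → let n = y ℕ.+ k ℕ.+ j in
    cycleCoefficient n j (+ y) ℚ.+ (inv n ℚ.* binomial (suc n) (+ j)) ℚ.* (inv (suc n) ℚ.* fromℕ k)
    ≡ fromℕ (suc y) ℚ.* inv (suc n) ℚ.* binomial (suc n) (+ j)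
  cycleCoefficient-step y k j = begin
    cycleCoefficient n j (+ y) ℚ.+ (I ℚ.* B) ℚ.* (I′ ℚ.* K)
      ≡⟨ ≡.cong (ℚ._+ (I ℚ.* B) ℚ.* (I′ ℚ.* K)) (cycleCoefficient-inv n j (+ y)) ⟩
    Y ℚ.* I ℚ.* c ℚ.+ (Y ℚ.+ 1ℚ) ℚ.* I ℚ.* c′ ℚ.+ (I ℚ.* B) ℚ.* (I′ ℚ.* K)
      ≡⟨ solve 7 (λ Y I c c′ B I′ K → Y :* I :* c :+ (Y :+ con 1ℚ) :* I :* c′ :+ (I :* B) :* (I′ :* K)
                    := I :* (Y :* (c :+ c′) :+ c′ :+ I′ :* K :* B)) ≡.refl Y I c c′ B I′ K ⟩
    I ℚ.* (Y ℚ.* (c ℚ.+ c′) ℚ.+ c′ ℚ.+ I′ ℚ.* K ℚ.* B)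
      ≡⟨ ≡.cong₂ (λ v w → I ℚ.* (Y ℚ.* v ℚ.+ w ℚ.+ I′ ℚ.* K ℚ.* B)) (binomial-pascal n j)
           (solveʳ (suc n) c′ (J ℚ.* B) (binomial-absorption n j)) ⟩
    I ℚ.* (Y ℚ.* B ℚ.+ I′ ℚ.* (J ℚ.* B) ℚ.+ I′ ℚ.* K ℚ.* B)
      ≡⟨ ≡.cong (λ v → I ℚ.* (v ℚ.+ I′ ℚ.* (J ℚ.* B) ℚ.+ I′ ℚ.* K ℚ.* B))
           (solveʳ (suc n) (Y ℚ.* B) (fromℕ (suc n) ℚ.* (Y ℚ.* B)) ≡.refl) ⟩
    I ℚ.* (I′ ℚ.* (fromℕ (suc n) ℚ.* (Y ℚ.* B)) ℚ.+ I′ ℚ.* (J ℚ.* B) ℚ.+ I′ ℚ.* K ℚ.* B)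
      ≡⟨ ≡.cong (λ v → I ℚ.* (I′ ℚ.* (v ℚ.* (Y ℚ.* B)) ℚ.+ I′ ℚ.* (J ℚ.* B) ℚ.+ I′ ℚ.* K ℚ.* B)) [1+n] ⟩
    I ℚ.* (I′ ℚ.* ((1ℚ ℚ.+ (Y ℚ.+ K ℚ.+ J)) ℚ.* (Y ℚ.* B)) ℚ.+ I′ ℚ.* (J ℚ.* B) ℚ.+ I′ ℚ.* K ℚ.* B)
      ≡⟨ solve 6 (λ I I′ Y K J B →
           I :* (I′ :* ((con 1ℚ :+ (Y :+ K :+ J)) :* (Y :* B)) :+ I′ :* (J :* B) :+ I′ :* K :* B)
           := I :* ((Y :+ K :+ J) :* ((con 1ℚ :+ Y) :* I′ :* B))) ≡.refl I I′ Y K J B ⟩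
    I ℚ.* ((Y ℚ.+ K ℚ.+ J) ℚ.* ((1ℚ ℚ.+ Y) ℚ.* I′ ℚ.* B))
      ≡⟨ ≡.cong₂ (λ v w → I ℚ.* (v ℚ.* (w ℚ.* I′ ℚ.* B))) [n] (fromℕ-+ 1 y) ⟨
    I ℚ.* (fromℕ n ℚ.* (fromℕ (suc y) ℚ.* I′ ℚ.* B))
      ≡⟨ solveʳ n (fromℕ (suc y) ℚ.* I′ ℚ.* B) _ ≡.refl ⟨
    fromℕ (suc y) ℚ.* I′ ℚ.* B ∎
    where
    n = y ℕ.+ k ℕ.+ j
    Y = fromℕ y
    K = fromℕ k
    J = fromℕ j
    I = inv n
    I′ = inv (suc n)
    B = binomial (suc n) (+ j)
    c = binomial n (+ j)
    c′ = binomial n (+ j ℤ.- + 1)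
    [n] : fromℕ n ≡ Y ℚ.+ K ℚ.+ J
    [n] = ≡.trans (fromℕ-+ (y ℕ.+ k) j) (≡.cong (ℚ._+ J) (fromℕ-+ y k))
    [1+n] : fromℕ (suc n) ≡ 1ℚ ℚ.+ (Y ℚ.+ K ℚ.+ J)
    [1+n] = ≡.trans (fromℕ-+ 1 n) (≡.cong (1ℚ ℚ.+_) [n])

open import Data.Product.Base using (_×_)
open import Defs

-- Bell polynomials

polySemiring : CommutativeSemiring 0ℓ 0ℓ
polySemiring = CommutativeRing.commutativeSemiring polyRing

module P = CommutativeSemiring polySemiring
module S¹ = PowerSeries polySemiring
module S² = PowerSeries S¹.commutativeSemiring

open Sums polySemiring
open S¹ using (_∗_; _^∗_)
open Mult P.semiring using () renaming (_×_ to _×ᴾ_)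
open SetoidReasoning P.setoid

module SolverP = Solver polySemiring

con-cong : ∀ {p q} → p ≡ q → con p ≈ con q
con-cong p≡q = P.reflexive (≡.cong con p≡q)

·-assoc : ∀ p q x → p · q · x ≈ (p ℚ.* q) · x
·-assoc p q x = P.trans (P.sym (P.*-assoc (con p) (con q) x)) (P.*-congʳ (P.sym (con-* p q)))

·-distribʳ : ∀ p q x → (p ℚ.+ q) · x ≈ p · x + q · x
·-distribʳ p q x = P.trans (P.*-congʳ (con-+ p q)) (P.distribʳ x (con p) (con q))

×≈· : ∀ n x → n ×ᴾ x ≈ fromℕ n · x
×≈· zero    x = P.sym (P.zeroˡ x)
×≈· (suc n) x = begin
  x + n ×ᴾ x                ≈⟨ P.+-cong (P.sym (P.*-identityˡ x)) (×≈· n x) ⟩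
  1ℚ · x + fromℕ n · x     ≈⟨ ·-distribʳ 1ℚ (fromℕ n) x ⟨
  (1ℚ ℚ.+ fromℕ n) · x     ≡⟨ ≡.cong (_· x) (fromℕ-+ 1 n) ⟨
  fromℕ (suc n) · x        ∎

inv-cancel : ∀ n .{{_ : NonZero n}} x → inv n · fromℕ n · x ≈ x
inv-cancel n x = begin
  inv n · fromℕ n · x       ≈⟨ ·-assoc (inv n) (fromℕ n) x ⟩
  (inv n ℚ.* fromℕ n) · x   ≡⟨ ≡.cong (_· x) (≡.trans (ℚ.*-comm (inv n) (fromℕ n)) (fromℕ-inv n)) ⟩
  1ℚ · x                    ≈⟨ P.*-identityˡ x ⟩
  x                         ∎

product-allFin : ∀ {n} (f : Fin n → Poly) → productOver (allFin n) f ≡ product f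
product-allFin {n} f = go n (λ i → i)
  where
  go : ∀ {n} k (g : Fin k → Fin n) {f : Fin n → Poly} → productOver (tabulate g) f ≡ product (f ∘ g)
  go zero    g     = ≡.refl
  go (suc k) g {f} = ≡.cong (f (g zero) *_) (go k (g ∘ suc))

positive : (ℕ → Poly) → ℕ → Poly
positive t zero    = con 0ℚ
positive t (suc n) = t (suc n)

-- A summand of the partial Bell polynomial divided by p!, with y i standing for xᵢ₊₁ / (i + 1)!.
bellTerm : ∀ {q} → (Fin q → Poly) → Vec ℕ q → Poly
bellTerm y rs = inv (∏! rs) {{∏!≢0 rs}} · product (λ i → y i ^ lookup rs i)

product-powers : ∀ {q} (y : Fin q → Poly) rs →
  product (λ i → 1/! (lookup rs i) · y i ^ lookup rs i) ≈ bellTerm y rs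
product-powers y []       = P.sym (P.*-identityˡ _)
product-powers y (r ∷ rs) = begin
  (1/! r · a) * product (λ i → 1/! (lookup rs i) · y (suc i) ^ lookup rs i)
    ≈⟨ P.*-congˡ (product-powers (y ∘ suc) rs) ⟩
  (1/! r · a) * (con (inv (∏! rs)) * b)
    ≈⟨ SolverP.solve 4 (λ x y z w → (x :* y) :* (z :* w) := (x :* z) :* (y :* w)) P.refl
         (con (1/! r)) a (con (inv (∏! rs))) b ⟩
  con (1/! r) * con (inv (∏! rs)) * (a * b)
    ≈⟨ P.*-congʳ (con-* (1/! r) (inv (∏! rs))) ⟨
  (1/! r ℚ.* inv (∏! rs)) · (a * b)
    ≡⟨ ≡.cong (_· (a * b)) (inv-* (r !) (∏! rs)) ⟨
  bellTerm y (r ∷ rs) ∎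
  where
  open SolverP using (_:*_; _:=_)
  a = y zero ^ r
  b = product (λ i → y (suc i) ^ lookup rs i)
  instance
    r!≢0 : NonZero (r !)
    r!≢0 = r ℕ.!≢0
    rs≢0 : NonZero (∏! rs)
    rs≢0 = ∏!≢0 rs

-- In the bivariate series the outer variable marks the number r of parts
-- and the inner one the degree p.
factor : Poly → ℕ → ℕ → ℕ → ℕ → Poly
factor y e s = S².monomial (S¹.monomial (1/! s · y ^ s) (e ℕ.* s)) s

degree : ∀ {q} → (Fin q → ℕ) → Vec ℕ q → ℕ
degree e rs = Vec.sum (Vec.tabulate λ i → e i ℕ.* lookup rs i)

-- Exponents add in both variables. For e i = i + 1 the vector rs therefore lands at the two
-- degrees, Σ rᵢ and Σ i rᵢ, that `IsBellIndex` prescribes.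
product-factors : ∀ {q} (y : Fin q → Poly) (e : Fin q → ℕ) rs r p →
  S².product∗ (λ i → factor (y i) (e i) (lookup rs i)) r p ≈
  S².monomial (S¹.monomial (bellTerm y rs) (degree e rs)) (Vec.sum rs) r p
product-factors y e rs r p = P.trans (go y e rs r p)
  (S².monomial-cong (S¹.monomial-cong (product-powers y rs) (degree e rs)) (Vec.sum rs) r p)
  where
  go : ∀ {q} (y : Fin q → Poly) (e : Fin q → ℕ) rs r p →
    S².product∗ (λ i → factor (y i) (e i) (lookup rs i)) r p ≈
    S².monomial (S¹.monomial (product λ i → 1/! (lookup rs i) · y i ^ lookup rs i)
                             (degree e rs)) (Vec.sum rs) r p
  go y e []       zero    zero    = P.refl
  go y e []       zero    (suc p) = P.refl
  go y e []       (suc r) p       = P.refl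
  go y e (s ∷ rs) r       p       = P.trans
    (S².∗-cong (λ _ _ → P.refl) (go (y ∘ suc) (e ∘ suc) rs) r p)
    (P.trans (S².monomial-* _ _ s (Vec.sum rs) r p)
             (S².monomial-cong (S¹.monomial-* _ _ (e zero ℕ.* s) _) (s ℕ.+ Vec.sum rs) r p))

-- The Boolean is the one to which `isBellIndex?` reduces, so the filter in `bellIndices` becomes
-- the extraction of a coefficient.
monomial²-if : ∀ x e a p r →
  S².monomial (S¹.monomial x e) a r p ≈ (if (a ℕ.≡ᵇ r) ∧ (e ℕ.≡ᵇ p) then x else con 0ℚ)
monomial²-if x e a p r = P.trans (S².monomial-≡ᵇ (S¹.monomial x e) a r p) select
  where
  select : (if a ℕ.≡ᵇ r then S¹.monomial x e else (λ _ → con 0ℚ)) p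
           ≈ (if (a ℕ.≡ᵇ r) ∧ (e ℕ.≡ᵇ p) then x else con 0ℚ)
  select with a ℕ.≡ᵇ r
  ... | true  = S¹.monomial-≡ᵇ x e p
  ... | false = P.refl

-- exp (y xᵉ z), z being the outer variable.
expSeries : Poly → ℕ → ℕ → ℕ → Poly
expSeries y e r = S¹.monomial (1/! r · y ^ r) (e ℕ.* r)

-- Coefficientwise: (r + 1) / (r + 1)! = 1 / r!, and the exponents of x satisfy e (r + 1) = e + e r.
isExp-expSeries : ∀ y e → S².IsExp (S¹.monomial y e) (expSeries y e)
isExp-expSeries y e .S².initial zero    rewrite ℕ.*-zeroʳ e = P.*-identityˡ _
isExp-expSeries y e .S².initial (suc n) rewrite ℕ.*-zeroʳ e = P.refl
isExp-expSeries y e .S².derivative r n = begin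
  (suc r S¹× expSeries y e (suc r)) n
    ≈⟨ S¹.×-pointwise (suc r) (expSeries y e (suc r)) n ⟩
  suc r ×ᴾ S¹.monomial (1/! (suc r) · y ^ suc r) (e ℕ.* suc r) n
    ≈⟨ S¹.×-monomial (suc r) _ (e ℕ.* suc r) n ⟩
  S¹.monomial (suc r ×ᴾ (1/! (suc r) · y ^ suc r)) (e ℕ.* suc r) n
    ≈⟨ S¹.monomial-cong coefficient (e ℕ.* suc r) n ⟩
  S¹.monomial (y * (1/! r · y ^ r)) (e ℕ.* suc r) n
    ≡⟨ ≡.cong (λ k → S¹.monomial (y * (1/! r · y ^ r)) k n) (ℕ.*-suc e r) ⟩
  S¹.monomial (y * (1/! r · y ^ r)) (e ℕ.+ e ℕ.* r) n
    ≈⟨ S¹.monomial-* y (1/! r · y ^ r) e (e ℕ.* r) n ⟨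
  (S¹.monomial y e ∗ expSeries y e r) n ∎
  where
  open Mult (CommutativeSemiring.semiring S¹.commutativeSemiring) using () renaming (_×_ to _S¹×_)
  open SolverP using (_:*_; _:=_)
  instance
    r!≢0 : NonZero (r !)
    r!≢0 = r ℕ.!≢0
  scalar : fromℕ (suc r) ℚ.* 1/! (suc r) ≡ 1/! r
  scalar = ≡.trans (≡.cong (fromℕ (suc r) ℚ.*_) (inv-* (suc r) (r !)))
    (≡.trans (≡.sym (ℚ.*-assoc (fromℕ (suc r)) (inv (suc r)) (1/! r)))
    (≡.trans (≡.cong (ℚ._* 1/! r) (fromℕ-inv (suc r))) (ℚ.*-identityˡ (1/! r))))
  coefficient : suc r ×ᴾ (1/! (suc r) · y ^ suc r) ≈ y * (1/! r · y ^ r)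
  coefficient = begin
    suc r ×ᴾ (1/! (suc r) · y ^ suc r)          ≈⟨ ×≈· (suc r) _ ⟩
    fromℕ (suc r) · 1/! (suc r) · y ^ suc r    ≈⟨ ·-assoc (fromℕ (suc r)) (1/! (suc r)) _ ⟩
    (fromℕ (suc r) ℚ.* 1/! (suc r)) · (y * y ^ r)  ≡⟨ ≡.cong (_· (y * y ^ r)) scalar ⟩
    1/! r · (y * y ^ r)                        ≈⟨ SolverP.solve 3 (λ a b c → a :* (b :* c) := b :* (a :* c))
                                                    P.refl (con (1/! r)) y (y ^ r) ⟩
    y * (1/! r · y ^ r)                        ∎

-- Both sides are r! times the coefficient of zʳ xᵖ in ∏ exp (tᵢ xⁱ z). Expanding every factor gives
-- the Bell sum; adding up the exponents first gives (Σ tᵢ xⁱ)ʳ / r!.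
bell-power : ∀ t p r → r ℕ.≤ p →
  fromℕ (r !) · Σ[ bellIndices p r ] (bellTerm (λ i → t (suc (toℕ i)))) ≈ (positive t ^∗ r) p
bell-power t p r r≤p = begin
  fromℕ (r !) · Σ[ bellIndices p r ] (bellTerm y)
    ≈⟨ P.*-congˡ (Σ-filter (isBellIndex? p r) (bellTerm y) (tuples (0to p) p)) ⟩
  fromℕ (r !) · Σ[ tuples (0to p) p ] (λ rs → if does (isBellIndex? p r rs) then bellTerm y rs else con 0ℚ)
    ≈⟨ P.*-congˡ (Σ-cong (tuples (0to p) p) (λ rs → P.trans (product-factors y e rs r p)
         (monomial²-if (bellTerm y rs) (degree e rs) (Vec.sum rs) p r))) ⟨
  fromℕ (r !) · Σ[ tuples (0to p) p ] (λ rs → M rs r p)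
    ≈⟨ P.*-congˡ (P.trans (S².Σ-pointwise M (tuples (0to p) p) r p)
         (S¹.Σ-pointwise (λ rs → M rs r) (tuples (0to p) p) p)) ⟨
  fromℕ (r !) · S².Σ∗[ tuples (0to p) p ] M r p
    ≈⟨ P.*-congˡ (Sums.Σ-product S².commutativeSemiring (0to p) p (λ i → factor (y i) (e i)) r p) ⟩
  fromℕ (r !) · S².product∗ (λ i → S².Σ∗[ 0to p ] (factor (y i) (e i))) r p
    -- Cutting every exponential off after zᵖ is invisible at zʳ, as r ≤ p.
    ≈⟨ P.*-congˡ (S².product∗-cong-≤ r (λ i s s≤r →
         S².Σ∗-monomial (expSeries (y i) (e i)) p s (ℕ.≤-trans s≤r r≤p)) p) ⟩
  fromℕ (r !) · S².product∗ (λ i → expSeries (y i) (e i)) r p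
    ≈⟨ ×≈· (r !) _ ⟨
  (r !) ×ᴾ S².product∗ (λ i → expSeries (y i) (e i)) r p
    ≈⟨ S¹.×-pointwise (r !) _ p ⟨
  ((r !) S¹× S².product∗ (λ i → expSeries (y i) (e i)) r) p
    ≈⟨ S².exp-power (S².IsExp-product (λ i → S¹.monomial (y i) (e i)) _
         (λ i → isExp-expSeries (y i) (e i))) r p ⟩
  (S¹.sum∗ (λ i → S¹.monomial (y i) (e i)) ^∗ r) p
    -- The generators stop at xᵖ, which suffices for the coefficient of xᵖ.
    ≈⟨ S¹.^∗-cong-≤ r p generators ⟩
  (positive t ^∗ r) p ∎
  where
  open Mult (CommutativeSemiring.semiring S¹.commutativeSemiring) using () renaming (_×_ to _S¹×_)
  y : Fin p → Poly
  y i = t (suc (toℕ i))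
  e : Fin p → ℕ
  e i = suc (toℕ i)
  M : Vec ℕ p → ℕ → ℕ → Poly
  M rs = S².product∗ (λ i → factor (y i) (e i) (lookup rs i))
  generators : ∀ n → n ℕ.≤ p → S¹.sum∗ (λ i → S¹.monomial (y i) (e i)) n ≈ positive t n
  generators zero    _   = S¹.sum-monomial-0 p y toℕ
  generators (suc n) n<p = P.trans (S¹.sum-monomial-suc p y toℕ n) (S¹.sum-monomial (t ∘ suc) p n n<p)

-- Potential polynomials

⋆≈∗ : ∀ F G n → (F ⋆ G) n ≈ (F ∗ G) n
⋆≈∗ F G zero    = P.+-identityʳ _
⋆≈∗ F G (suc n) = P.trans (Σ-suc (λ i → F i * G (suc n ℕ.∸ i)) n) (P.+-congˡ (⋆≈∗ (F ∘ suc) G n))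

^ˢ≈^∗ : ∀ {F G} → (∀ n → F n ≈ G n) → ∀ r n → (F ^ˢ r) n ≈ (G ^∗ r) n
^ˢ≈^∗ F≈G zero    zero    = P.refl
^ˢ≈^∗ F≈G zero    (suc n) = P.refl
^ˢ≈^∗ F≈G (suc r) n       = P.trans (⋆≈∗ _ _ n) (S¹.∗-cong F≈G (^ˢ≈^∗ F≈G r) n)

∗-Σ : ∀ {A : Set} F (a : A → Poly) (G : A → ℕ → Poly) xs n →
  (F ∗ (λ i → Σ[ xs ] (λ x → a x * G x i))) n ≈ Σ[ xs ] (λ x → a x * (F ∗ G x) n)
∗-Σ F a G []       n = CommutativeSemiring.zeroʳ S¹.commutativeSemiring F n
∗-Σ F a G (x ∷ xs) n = P.trans
  (CommutativeSemiring.distribˡ S¹.commutativeSemiring F (λ i → a x * G x i) _ n)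
  (P.+-cong (S¹.∗-scaleʳ (a x) F (G x) n) (∗-Σ F a G xs n))

-- The top coefficient G n only meets the constant term of F, which is zero.
∗-cong-< : ∀ {F G G′} → F 0 ≈ con 0ℚ → ∀ n → (∀ i → i ℕ.< n → G i ≈ G′ i) → (F ∗ G) n ≈ (F ∗ G′) n
∗-cong-< {F} {G} {G′} F0 n G≈G′ = go n G≈G′
  where
  vanish : ∀ x y → F 0 * x ≈ F 0 * y
  vanish x y = P.trans (P.trans (P.*-congʳ F0) (P.zeroˡ x)) (P.sym (P.trans (P.*-congʳ F0) (P.zeroˡ y)))
  go : ∀ n → (∀ i → i ℕ.< n → G i ≈ G′ i) → (F ∗ G) n ≈ (F ∗ G′) n
  go zero    _    = vanish _ _
  go (suc n) G≈G′ = P.+-cong (vanish _ _)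
    (S¹.∗-cong-≤ n (λ _ _ → P.refl) (λ i i≤n → G≈G′ i (s≤s i≤n)))

-- The binomial theorem for (1 + g)ᴺ, from Fᴺ⁺¹ = Fᴺ + g Fᴺ and Pascal's rule. As g has no constant
-- term, gʳ starts in degree r, so any bound b ≥ n on r yields the whole sum.
one+-^∗ : ∀ {F g} → g 0 ≈ con 0ℚ → (∀ n → F n ≈ S¹.one n + g n) → ∀ N b n → n ℕ.≤ b →
  (F ^∗ N) n ≈ Σ[ 0to b ] (λ r → fromℕ (N C r) · (g ^∗ r) n)
one+-^∗ {F} {g} g0 F≈1+g = go
  where
  unfold : ∀ N n → (F ^∗ suc N) n ≈ (F ^∗ N) n + (g ∗ F ^∗ N) n
  unfold N n = P.trans (S¹.∗-cong F≈1+g (λ _ → P.refl) n)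
    (P.trans (S¹.∗-distribʳ (F ^∗ N) S¹.one g n) (P.+-congʳ (S¹.∗-identityˡ (F ^∗ N) n)))
  go : ∀ N b n → n ℕ.≤ b → (F ^∗ N) n ≈ Σ[ 0to b ] (λ r → fromℕ (N C r) · (g ^∗ r) n)
  go zero zero    n _ = P.sym (P.trans (P.+-identityʳ _) (P.*-identityˡ _))
  go zero (suc b) n _ = P.sym (begin
    Σ[ 0to (suc b) ] (λ r → fromℕ (0 C r) · (g ^∗ r) n)
      ≈⟨ Σ-suc _ b ⟩
    1ℚ · S¹.one n + Σ[ 0to b ] (λ r → fromℕ (0 C suc r) · (g ^∗ suc r) n)
      ≈⟨ P.+-cong (P.*-identityˡ _) (P.trans (Σ-cong (0to b) (λ r →
           P.trans (P.*-congʳ (con-cong (≡.cong fromℕ (k>n⇒nCk≡0 {0} {suc r} (s≤s z≤n))))) (P.zeroˡ _)))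
           (Σ-zero (0to b))) ⟩
    S¹.one n + con 0ℚ
      ≈⟨ P.+-identityʳ _ ⟩
    S¹.one n ∎)
  go (suc N) zero zero _ = begin
    (F ^∗ suc N) 0                            ≈⟨ unfold N 0 ⟩
    (F ^∗ N) 0 + g 0 * (F ^∗ N) 0             ≈⟨ P.+-congˡ (P.trans (P.*-congʳ g0) (P.zeroˡ _)) ⟩
    (F ^∗ N) 0 + con 0ℚ                       ≈⟨ P.+-identityʳ _ ⟩
    (F ^∗ N) 0                                ≈⟨ go N 0 0 z≤n ⟩
    fromℕ (suc N C 0) · con 1ℚ + con 0ℚ       ∎
  go (suc N) (suc b) n n≤1+b = begin
    (F ^∗ suc N) n
      ≈⟨ unfold N n ⟩
    (F ^∗ N) n + (g ∗ F ^∗ N) n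
      -- In the second summand the factor g raises r by one, so the bound there is b; this is enough
      -- because only degrees of Fᴺ below n meet g.
      ≈⟨ P.+-cong (go N (suc b) n n≤1+b)
           (P.trans (∗-cong-< g0 n (λ i i<n → go N b i (ℕ.s≤s⁻¹ (ℕ.≤-trans i<n n≤1+b))))
                    (∗-Σ g (λ r → con (fromℕ (N C r))) (g ^∗_) (0to b) n)) ⟩
    Σ[ 0to (suc b) ] (λ r → fromℕ (N C r) · (g ^∗ r) n) + Σ[ 0to b ] (λ r → fromℕ (N C r) · (g ^∗ suc r) n)
      ≈⟨ P.+-congʳ (Σ-suc _ b) ⟩
    fromℕ (N C 0) · (g ^∗ 0) n + Σ[ 0to b ] (λ r → fromℕ (N C suc r) · (g ^∗ suc r) n)
      + Σ[ 0to b ] (λ r → fromℕ (N C r) · (g ^∗ suc r) n)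
      ≈⟨ P.+-assoc _ _ _ ⟩
    fromℕ (N C 0) · (g ^∗ 0) n + (Σ[ 0to b ] (λ r → fromℕ (N C suc r) · (g ^∗ suc r) n)
      + Σ[ 0to b ] (λ r → fromℕ (N C r) · (g ^∗ suc r) n))
      ≈⟨ P.+-congˡ (P.trans (P.sym (Σ-+ _ _ (0to b))) (Σ-cong (0to b) pascal)) ⟩
    fromℕ (suc N C 0) · (g ^∗ 0) n + Σ[ 0to b ] (λ r → fromℕ (suc N C suc r) · (g ^∗ suc r) n)
      ≈⟨ Σ-suc _ b ⟨
    Σ[ 0to (suc b) ] (λ r → fromℕ (suc N C r) · (g ^∗ r) n) ∎
    where
    pascal : ∀ r → fromℕ (N C suc r) · (g ^∗ suc r) n + fromℕ (N C r) · (g ^∗ suc r) n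
                 ≈ fromℕ (suc N C suc r) · (g ^∗ suc r) n
    pascal r = P.trans (P.sym (·-distribʳ (fromℕ (N C suc r)) (fromℕ (N C r)) _))
      (P.*-congʳ (con-cong (≡.trans (≡.sym (fromℕ-+ (N C suc r) (N C r)))
        (≡.cong fromℕ (≡.trans (ℕ.+-comm (N C suc r) (N C r)) (nCk+nC[k+1]≡[n+1]C[k+1] N r))))))

t : ℕ → Poly
t zero    = con 1ℚ
t (suc i) = var (suc i)

factorialVar : ℕ → Poly
factorialVar i = fromℕ (i !) · var i

1/!-cancel : ∀ n x → 1/! n · fromℕ (n !) · x ≈ x
1/!-cancel n = inv-cancel (n !) {{n ℕ.!≢0}}

-- At the arguments i! tᵢ the exponential generating function loses its factorials and becomes T.
1+egf-factorialVar : ∀ n → 1+egf factorialVar n ≈ t n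
1+egf-factorialVar zero    = P.refl
1+egf-factorialVar (suc n) = 1/!-cancel (suc n) (var (suc n))

𝐏-t : ∀ p N → 1/! p · 𝐏 p N factorialVar ≈ (t ^∗ N) p
𝐏-t p N = P.trans (1/!-cancel p _) (^ˢ≈^∗ 1+egf-factorialVar N p)

𝐁-positive : ∀ p r → r ℕ.≤ p →
  (fromℕ (r !) ℚ.* 1/! p) · 𝐁 p r factorialVar ≈ (positive t ^∗ r) p
𝐁-positive p r r≤p = begin
  (fromℕ (r !) ℚ.* 1/! p) · 𝐁 p r factorialVar
    ≈⟨ P.*-congˡ (P.trans (Σ-cong (bellIndices p r) term) (Σ-*ˡ (con (fromℕ (p !))) _ (bellIndices p r))) ⟩
  (fromℕ (r !) ℚ.* 1/! p) · fromℕ (p !) · Σ[ bellIndices p r ] (bellTerm y)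
    ≈⟨ ·-assoc (fromℕ (r !)) (1/! p) _ ⟨
  fromℕ (r !) · 1/! p · fromℕ (p !) · Σ[ bellIndices p r ] (bellTerm y)
    ≈⟨ P.*-congˡ (1/!-cancel p _) ⟩
  fromℕ (r !) · Σ[ bellIndices p r ] (bellTerm y)
    ≈⟨ bell-power t p r r≤p ⟩
  (positive t ^∗ r) p ∎
  where
  y : Fin p → Poly
  y i = t (suc (toℕ i))
  term : ∀ rs → ((+ (p !) ℚ./ ∏! rs) {{∏!≢0 rs}}) ·
                  (∏[ i ∈ allFin p ] (1/! suc (toℕ i) · factorialVar (suc (toℕ i))) ^ lookup rs i)
              ≈ fromℕ (p !) · bellTerm y rs
  term rs = P.trans
    (P.*-cong (con-cong (/-inv (+ (p !)) (∏! rs) {{∏!≢0 rs}}))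
      (P.trans (P.reflexive (product-allFin (λ i → 1+egf factorialVar (suc (toℕ i)) ^ lookup rs i)))
        (product-cong (λ i → Exp.^-congˡ P.semiring (lookup rs i) (1+egf-factorialVar (suc (toℕ i)))))))
    (P.sym (·-assoc (fromℕ (p !)) (inv (∏! rs) {{∏!≢0 rs}}) _))

-- Expands Tᴺ = (1 + (T - 1))ᴺ; the powers of T - 1 are Bell polynomials by `𝐁-positive`, and those
-- with r > p contribute nothing at xᵖ.
potential-bell : ∀ N p → (t ^∗ N) p ≈
  ∑[ r ∈ 0to p ] ((binomial N (+ r) ℚ.* fromℕ (r !) ℚ.* 1/! p) · 𝐁 p r factorialVar)
potential-bell N p = P.trans (one+-^∗ P.refl t≈1+positive N p p ℕ.≤-refl) (Σ-cong-≤ p term)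
  where
  t≈1+positive : ∀ n → t n ≈ S¹.one n + positive t n
  t≈1+positive zero    = P.sym (P.+-identityʳ _)
  t≈1+positive (suc n) = P.sym (P.+-identityˡ _)
  term : ∀ r → r ℕ.≤ p → fromℕ (N C r) · (positive t ^∗ r) p
                       ≈ (binomial N (+ r) ℚ.* fromℕ (r !) ℚ.* 1/! p) · 𝐁 p r factorialVar
  term r r≤p = begin
    fromℕ (N C r) · (positive t ^∗ r) p
      ≈⟨ P.*-congˡ (𝐁-positive p r r≤p) ⟨
    fromℕ (N C r) · (fromℕ (r !) ℚ.* 1/! p) · 𝐁 p r factorialVar
      ≈⟨ ·-assoc (fromℕ (N C r)) (fromℕ (r !) ℚ.* 1/! p) _ ⟩
    (fromℕ (N C r) ℚ.* (fromℕ (r !) ℚ.* 1/! p)) · 𝐁 p r factorialVar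
      ≡⟨ ≡.cong (_· 𝐁 p r factorialVar) (ℚ.*-assoc (fromℕ (N C r)) (fromℕ (r !)) (1/! p)) ⟨
    (fromℕ (N C r) ℚ.* fromℕ (r !) ℚ.* 1/! p) · 𝐁 p r factorialVar ∎

-- Weights of paths

∏-1to : ∀ (f : ℕ → Poly) n → productOver (1to n) f ≡ productOver (upTo n) (f ∘ suc)
∏-1to f n = foldr-map _ suc (con 1ℚ) (upTo n)

∏-1to-suc : ∀ (f : ℕ → Poly) n → productOver (1to (suc n)) f ≡ f 1 * productOver (1to n) (f ∘ suc)
∏-1to-suc f n = ≡.trans (∏-1to f (suc n))
  (≡.cong (λ xs → f 1 * productOver xs (f ∘ suc)) (≡.sym (map-upTo suc n)))

∏-one : ∀ {A : Set} (f : A → Poly) xs → (∀ x → f x ≈ con 1ℚ) → productOver xs f ≈ con 1ℚ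
∏-one f []       f≈1 = P.refl
∏-one f (x ∷ xs) f≈1 = P.trans (P.*-cong (f≈1 x) (∏-one f xs f≈1)) (P.*-identityˡ _)

∏-* : ∀ {A : Set} (f g : A → Poly) xs → productOver xs (λ x → f x * g x) ≈ productOver xs f * productOver xs g
∏-* f g []       = P.sym (P.*-identityˡ _)
∏-* f g (x ∷ xs) = P.trans (P.*-congˡ (∏-* f g xs))
  (solve 4 (λ a b c e → (a :* b) :* (c :* e) := (a :* c) :* (b :* e)) P.refl (f x) (g x) _ _)
  where open SolverP using (solve; _:*_; _:=_)

∏-cong : ∀ {A : Set} {f g : A → Poly} xs → (∀ x → f x ≈ g x) → productOver xs f ≈ productOver xs g
∏-cong []       f≈g = P.refl
∏-cong (x ∷ xs) f≈g = P.*-cong (f≈g x) (∏-cong xs f≈g)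

-- The weight τ at the length of the leading u-segment, each `u` shifting τ by one. A word of
-- up-steps only gets 1, in line with `β`, where a segment counts only if `d` or `h` follows.
lead : (ℕ → Poly) → List Step → Poly
lead τ []      = con 1ℚ
lead τ (u ∷ w) = lead (τ ∘ suc) w
lead τ (d ∷ w) = τ 0
lead τ (h ∷ w) = τ 0

-- The weight in a form that recurses on the word: behind each `d` or `h` stands a possibly empty
-- u-segment, and t₀ = 1 discards the empty ones.
segments : List Step → Poly
segments []      = con 1ℚ
segments (u ∷ w) = segments w
segments (d ∷ w) = lead t w * segments w
segments (h ∷ w) = lead t w * segments w

lead-one : ∀ w → lead (λ _ → con 1ℚ) w ≡ con 1ℚ
lead-one []      = ≡.refl
lead-one (u ∷ w) = lead-one w
lead-one (d ∷ w) = ≡.refl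
lead-one (h ∷ w) = ≡.refl

private
  [_] : Bool → ℕ
  [ b ] = if b then 1 else 0

-- At most one i satisfies `beginsWith i w`, namely the length of the leading segment. Index 0 is
-- kept apart from the product so that shifting τ along a `u` moves the factor at 1 into its place.
∏-beginsWith : ∀ τ w n → length w ℕ.≤ n →
  τ 0 ^ [ beginsWith 0 w ] * productOver (1to n) (λ i → τ i ^ [ beginsWith i w ]) ≈ lead τ w
∏-beginsWith τ []      n       _         =
  P.trans (P.*-identityˡ _) (∏-one _ (1to n) λ { zero → P.refl ; (suc i) → P.refl })
∏-beginsWith τ (u ∷ w) (suc n) (s≤s w≤n) =
  P.trans (P.*-identityˡ _) (P.trans (P.reflexive (∏-1to-suc _ n)) (∏-beginsWith (τ ∘ suc) w n w≤n))
∏-beginsWith τ (d ∷ w) n       _         = P.trans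
  (P.*-cong (P.*-identityʳ (τ 0)) (P.trans (P.reflexive (∏-1to _ n)) (∏-one _ (upTo n) (λ _ → P.refl))))
  (P.*-identityʳ (τ 0))
∏-beginsWith τ (h ∷ w) n       _         = P.trans
  (P.*-cong (P.*-identityʳ (τ 0)) (P.trans (P.reflexive (∏-1to _ n)) (∏-one _ (upTo n) (λ _ → P.refl))))
  (P.*-identityʳ (τ 0))

∏-first-segment : ∀ w n → length w ℕ.≤ n →
  productOver (1to n) (λ i → var i ^ ([ beginsWith i w ] ℕ.+ β i w)) ≈
  lead t w * productOver (1to n) (λ i → var i ^ β i w)
∏-first-segment w n w≤n = begin
  productOver (1to n) (λ i → var i ^ ([ beginsWith i w ] ℕ.+ β i w))
    ≈⟨ ∏-cong (1to n) (λ i → Exp.^-homo-* P.semiring (var i) [ beginsWith i w ] (β i w)) ⟩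
  productOver (1to n) (λ i → var i ^ [ beginsWith i w ] * var i ^ β i w)
    ≈⟨ ∏-* _ _ (1to n) ⟩
  productOver (1to n) (λ i → var i ^ [ beginsWith i w ]) * productOver (1to n) (λ i → var i ^ β i w)
    ≈⟨ P.*-congʳ leading ⟩
  lead t w * productOver (1to n) (λ i → var i ^ β i w) ∎
  where
  one^[_] : ∀ b → con 1ℚ ^ [ b ] ≈ con 1ℚ
  one^[ true ]  = P.*-identityʳ (con 1ℚ)
  one^[ false ] = P.refl
  leading : productOver (1to n) (λ i → var i ^ [ beginsWith i w ]) ≈ lead t w
  leading = begin
    productOver (1to n) (λ i → var i ^ [ beginsWith i w ])
      -- `var` and `t` agree from index 1 on; the factor at index 0 can then be inserted since t₀ =
      -- 1.
      ≡⟨ ≡.trans (∏-1to _ n) (≡.sym (∏-1to (λ i → t i ^ [ beginsWith i w ]) n)) ⟩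
    productOver (1to n) (λ i → t i ^ [ beginsWith i w ])
      ≈⟨ P.trans (P.*-congʳ one^[ beginsWith 0 w ]) (P.*-identityˡ _) ⟨
    t 0 ^ [ beginsWith 0 w ] * productOver (1to n) (λ i → t i ^ [ beginsWith i w ])
      ≈⟨ ∏-beginsWith t w n w≤n ⟩
    lead t w ∎

-- The bound n is separate from the length: it stays fixed while the word gets shorter.
∏-β : ∀ w n → length w ℕ.≤ n → productOver (1to n) (λ i → var i ^ β i w) ≈ segments w
∏-β []      n _   = ∏-one _ (1to n) (λ _ → P.refl)
∏-β (u ∷ w) n w<n = ∏-β w n (ℕ.<⇒≤ w<n)
∏-β (d ∷ w) n w<n = P.trans (∏-first-segment w n (ℕ.<⇒≤ w<n)) (P.*-congˡ (∏-β w n (ℕ.<⇒≤ w<n)))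
∏-β (h ∷ w) n w<n = P.trans (∏-first-segment w n (ℕ.<⇒≤ w<n)) (P.*-congˡ (∏-β w n (ℕ.<⇒≤ w<n)))

weight-segments : ∀ w → weight w ≈ segments w
weight-segments w = ∏-β w (length w) ℕ.≤-refl

-- Whether the word leads from height y to 0, never below 0, with k up-steps and
-- j horizontal steps.
descends : List Step → ℕ → ℕ → ℕ → Bool
descends []      zero    zero    zero    = true
descends []      _       _       _       = false
descends (u ∷ w) y       (suc k) j       = descends w (suc y) k j
descends (u ∷ w) y       zero    j       = false
descends (d ∷ w) (suc y) k       j       = descends w y k j
descends (d ∷ w) zero    k       j       = false
descends (h ∷ w) y       k       (suc j) = descends w y k j
descends (h ∷ w) y       k       zero    = false

-- The cycle lemma

total : ℕ → (ℕ → Poly) → ℕ → ℕ → ℕ → Poly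
total l τ y k j = Σ[ words l ] (λ w → if descends w y k j then lead τ w * segments w else con 0ℚ)

Σ-words : ∀ (f : List Step → Poly) l →
  Σ[ words (suc l) ] f ≈ Σ[ words l ] (f ∘ (u ∷_)) + (Σ[ words l ] (f ∘ (d ∷_)) + Σ[ words l ] (f ∘ (h ∷_)))
Σ-words f l = begin
  Σ[ words (suc l) ] f
    ≈⟨ Σ-map f Vec.toList (tuples steps (suc l)) ⟩
  Σ[ tuples steps (suc l) ] (f ∘ Vec.toList)
    ≈⟨ Σ-cartesianProductWith (f ∘ Vec.toList) _∷_ steps (tuples steps l) ⟩
  part u + (part d + (part h + con 0ℚ))
    ≈⟨ P.+-congˡ (P.+-congˡ (P.+-identityʳ (part h))) ⟩
  part u + (part d + part h)
    ≈⟨ P.+-cong (unmap u) (P.+-cong (unmap d) (unmap h)) ⟨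
  Σ[ words l ] (f ∘ (u ∷_)) + (Σ[ words l ] (f ∘ (d ∷_)) + Σ[ words l ] (f ∘ (h ∷_))) ∎
  where
  steps : List Step
  steps = u ∷ d ∷ h ∷ []
  part : Step → Poly
  part s = Σ[ tuples steps l ] (λ v → f (s ∷ Vec.toList v))
  unmap : ∀ s → Σ[ words l ] (f ∘ (s ∷_)) ≈ part s
  unmap s = Σ-map (f ∘ (s ∷_)) Vec.toList (tuples steps l)

total-factor : ∀ x l y k j →
  Σ[ words l ] (λ w → if descends w y k j then x * (lead t w * segments w) else con 0ℚ) ≈ x * total l t y k j
total-factor x l y k j = P.trans (Σ-cong (words l) (λ w → pull (descends w y k j) (lead t w * segments w)))
  (Σ-*ˡ x _ (words l))
  where
  pull : ∀ b z → (if b then x * z else con 0ℚ) ≈ x * (if b then z else con 0ℚ)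
  pull true  z = P.refl
  pull false z = P.sym (P.zeroʳ x)

-- Behind the first block uᵃ s there remain, with the final d appended, n + 1 blocks from height y +
-- a - 1 or y + a, according to s; `cycle` counts both. A leading `u` is absorbed by passing to
-- `τ ∘ suc` and `suc y`, which keeps the total height y + a. The free τ also covers the initial
-- segment of a path, whose weight is 1.
first-block : ∀ l τ y k j n → suc l ≡ y ℕ.+ (k ℕ.+ k) ℕ.+ j → suc n ≡ y ℕ.+ k ℕ.+ j →
  total (suc l) τ y k j ≈ ((λ a → con (cycleCoefficient (suc n) j (+ (y ℕ.+ a))) * τ a) ∗ t ^∗ suc n) k

-- Of the l steps n are `d` or `h`, and the appended d makes n + 1 blocks. The affine coefficient in
-- `first-block` splits the sum over a into a multiple of [xᵏ] Tⁿ⁺¹ and one of Σ a tₐ [xᵏ⁻ᵃ] Tⁿ,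
-- which the power rule evaluates; `cycleCoefficient-step` adds the two.
cycle : ∀ l y k j n → l ≡ y ℕ.+ (k ℕ.+ k) ℕ.+ j → n ≡ y ℕ.+ k ℕ.+ j →
  total l t y k j ≈ (fromℕ (suc y) ℚ.* inv (suc n) ℚ.* binomial (suc n) (+ j)) · (t ^∗ suc n) k

first-block l τ y k j n l≡ n≡ = P.trans (Σ-words _ l) (combine k l≡ n≡)
  where
  N = suc n
  Φ = t ^∗ N
  after-d : ∀ y k → suc l ≡ y ℕ.+ (k ℕ.+ k) ℕ.+ j → suc n ≡ y ℕ.+ k ℕ.+ j →
    Σ[ words l ] (λ w → if descends (d ∷ w) y k j then τ 0 * (lead t w * segments w) else con 0ℚ)
    ≈ τ 0 * ((fromℕ y ℚ.* inv N ℚ.* binomial N (+ j)) · Φ k)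
  -- No `d` is possible at height 0, in accordance with the factor y = 0.
  after-d zero    k _  _  = P.trans (Σ-zero (words l)) (P.sym (P.trans
    (P.*-congˡ (P.trans (P.*-congʳ (con-cong (≡.trans (≡.cong (ℚ._* binomial N (+ j)) (ℚ.*-zeroˡ (inv N)))
      (ℚ.*-zeroˡ (binomial N (+ j)))))) (P.zeroˡ (Φ k)))) (P.zeroʳ (τ 0))))
  after-d (suc y) k l≡ n≡ = P.trans (total-factor (τ 0) l y k j)
    (P.*-congˡ (cycle l y k j n (ℕ.suc-injective l≡) (ℕ.suc-injective n≡)))
  after-h : ∀ k j → suc l ≡ y ℕ.+ (k ℕ.+ k) ℕ.+ j → suc n ≡ y ℕ.+ k ℕ.+ j →
    Σ[ words l ] (λ w → if descends (h ∷ w) y k j then τ 0 * (lead t w * segments w) else con 0ℚ)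
    ≈ τ 0 * ((fromℕ (suc y) ℚ.* inv N ℚ.* binomial N (+ j ℤ.- + 1)) · Φ k)
  -- With j = 0 no `h` is left, in accordance with the binomial coefficient at -1.
  after-h k zero    _  _  = P.trans (Σ-zero (words l)) (P.sym (P.trans
    (P.*-congˡ (P.trans (P.*-congʳ (con-cong (ℚ.*-zeroʳ (fromℕ (suc y) ℚ.* inv N)))) (P.zeroˡ (Φ k))))
    (P.zeroʳ (τ 0))))
  after-h k (suc j) l≡ n≡ = P.trans (total-factor (τ 0) l y k j)
    (P.*-congˡ (cycle l y k j n (ℕ.suc-injective (≡.trans l≡ (ℕ.+-suc _ j)))
                                (ℕ.suc-injective (≡.trans n≡ (ℕ.+-suc _ j)))))
  head-term : ∀ x → τ 0 * ((fromℕ y ℚ.* inv N ℚ.* binomial N (+ j)) · x)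
                  + τ 0 * ((fromℕ (suc y) ℚ.* inv N ℚ.* binomial N (+ j ℤ.- + 1)) · x)
                  ≈ con (cycleCoefficient N j (+ (y ℕ.+ 0))) * τ 0 * x
  head-term x = begin
    τ 0 * (p · x) + τ 0 * (q · x)      ≈⟨
      solve 4 (λ a b c e → a :* (b :* e) :+ a :* (c :* e) := (b :+ c) :* a :* e) P.refl (τ 0) (con p) (con q) x ⟩
    (con p + con q) * τ 0 * x      ≈⟨ P.*-congʳ (P.*-congʳ (con-+ p q)) ⟨
    con (p ℚ.+ q) * τ 0 * x        ≈⟨ P.*-congʳ (P.*-congʳ (con-cong coefficient)) ⟩
    con (cycleCoefficient N j (+ (y ℕ.+ 0))) * τ 0 * x ∎
    where
    open SolverP using (solve; _:*_; _:+_; _:=_)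
    p = fromℕ y ℚ.* inv N ℚ.* binomial N (+ j)
    q = fromℕ (suc y) ℚ.* inv N ℚ.* binomial N (+ j ℤ.- + 1)
    coefficient : p ℚ.+ q ≡ cycleCoefficient N j (+ (y ℕ.+ 0))
    coefficient = ≡.trans
      (≡.cong (λ z → p ℚ.+ z ℚ.* inv N ℚ.* binomial N (+ j ℤ.- + 1))
              (≡.trans (fromℕ-+ 1 y) (ℚ.+-comm 1ℚ (fromℕ y))))
      (≡.trans (≡.sym (cycleCoefficient-inv N j (+ y)))
               (≡.cong (λ z → cycleCoefficient N j (+ z)) (≡.sym (ℕ.+-identityʳ y))))
  combine : ∀ k → suc l ≡ y ℕ.+ (k ℕ.+ k) ℕ.+ j → suc n ≡ y ℕ.+ k ℕ.+ j →
    Σ[ words l ] (λ w → if descends (u ∷ w) y k j then lead (τ ∘ suc) w * segments w else con 0ℚ)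
    + (Σ[ words l ] (λ w → if descends (d ∷ w) y k j then τ 0 * (lead t w * segments w) else con 0ℚ)
    + Σ[ words l ] (λ w → if descends (h ∷ w) y k j then τ 0 * (lead t w * segments w) else con 0ℚ))
    ≈ ((λ a → con (cycleCoefficient N j (+ (y ℕ.+ a))) * τ a) ∗ Φ) k
  combine zero    l≡ n≡ = P.trans (P.+-congʳ (Σ-zero (words l))) (P.trans (P.+-identityˡ _)
    (P.trans (P.+-cong (after-d y 0 l≡ n≡) (after-h 0 j l≡ n≡)) (head-term (Φ 0))))
  -- The convolution peels in the same way: its head a = 0 collects the words starting with `d` or
  -- `h`, its tail those starting with `u`.
  combine (suc k) l≡ n≡ = P.trans (P.+-comm _ _) (P.+-cong
    (P.trans (P.+-cong (after-d y (suc k) l≡ n≡) (after-h (suc k) j l≡ n≡)) (head-term (Φ (suc k))))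
    (after-u l (≡.trans l≡ length-u)))
    where
    length-u : y ℕ.+ (suc k ℕ.+ suc k) ℕ.+ j ≡ 2 ℕ.+ (y ℕ.+ (k ℕ.+ k) ℕ.+ j)
    length-u = solve 3 (λ y k j → y :+ (con 1 :+ k :+ (con 1 :+ k)) :+ j := con 2 :+ (y :+ (k :+ k) :+ j))
                 ≡.refl y k j
      where open +-*-Solver using (solve; con; _:+_; _:=_)
    after-u : ∀ l → suc l ≡ 2 ℕ.+ (y ℕ.+ (k ℕ.+ k) ℕ.+ j) →
      total l (τ ∘ suc) (suc y) k j
      ≈ ((λ a → con (cycleCoefficient N j (+ (y ℕ.+ suc a))) * τ (suc a)) ∗ Φ) k
    -- A `u` must be followed by at least one more step, so the remaining length is again a
    -- successor, as `first-block` requires.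
    after-u (suc l) l≡ = P.trans
      (first-block l (τ ∘ suc) (suc y) k j n (ℕ.suc-injective l≡)
                   (≡.trans n≡ (≡.cong (ℕ._+ j) (ℕ.+-suc y k))))
      (S¹.∗-cong (λ a → P.*-congʳ (con-cong
                   (≡.cong (λ z → cycleCoefficient N j (+ z)) (≡.sym (ℕ.+-suc y a)))))
                 (λ _ → P.refl) k)

cycle zero    zero zero zero zero _ _ = P.trans (P.+-identityʳ _) (P.*-congˡ (P.sym (P.*-identityˡ _)))
cycle (suc l) zero zero zero zero () _
cycle (suc l) y k j (suc n) l≡ n≡ = begin
  total (suc l) t y k j
    ≈⟨ first-block l t y k j n l≡ n≡ ⟩
  ((λ a → con (cycleCoefficient N j (+ (y ℕ.+ a))) * t a) ∗ Φ) k
    ≈⟨ S¹.∗-cong expand (λ _ → P.refl) k ⟩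
  ((λ a → con α * t a + con γ * S¹.ϑ t a) ∗ Φ) k
    ≈⟨ P.trans (S¹.∗-distribʳ Φ (λ a → con α * t a) _ k)
         (P.+-cong (S¹.∗-scaleˡ (con α) t Φ k) (S¹.∗-scaleˡ (con γ) (S¹.ϑ t) Φ k)) ⟩
  α · (t ^∗ suc N) k + γ · (S¹.ϑ t ∗ Φ) k
    ≈⟨ P.+-congˡ (P.*-congˡ euler) ⟩
  α · (t ^∗ suc N) k + γ · (inv (suc N) ℚ.* fromℕ k) · (t ^∗ suc N) k
    ≈⟨ P.+-congˡ (·-assoc γ _ _) ⟩
  α · (t ^∗ suc N) k + (γ ℚ.* (inv (suc N) ℚ.* fromℕ k)) · (t ^∗ suc N) k
    ≈⟨ ·-distribʳ α _ _ ⟨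
  (α ℚ.+ γ ℚ.* (inv (suc N) ℚ.* fromℕ k)) · (t ^∗ suc N) k
    ≈⟨ P.*-congʳ (con-cong (step N n≡)) ⟩
  (fromℕ (suc y) ℚ.* inv (suc N) ℚ.* binomial (suc N) (+ j)) · (t ^∗ suc N) k ∎
  where
  N = suc n
  Φ = t ^∗ N
  α = cycleCoefficient N j (+ y)
  γ = inv N ℚ.* binomial (suc N) (+ j)
  expand : ∀ a → con (cycleCoefficient N j (+ (y ℕ.+ a))) * t a ≈ con α * t a + con γ * S¹.ϑ t a
  expand a = begin
    con (cycleCoefficient N j (+ (y ℕ.+ a))) * t a   ≈⟨ P.*-congʳ (con-cong (cycleCoefficient-+ N j y a)) ⟩
    (α ℚ.+ γ ℚ.* fromℕ a) · t a                      ≈⟨ ·-distribʳ α (γ ℚ.* fromℕ a) (t a) ⟩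
    α · t a + (γ ℚ.* fromℕ a) · t a                  ≈⟨ P.+-congˡ (·-assoc γ (fromℕ a) (t a)) ⟨
    α · t a + γ · fromℕ a · t a                      ≈⟨ P.+-congˡ (P.*-congˡ (×≈· a (t a))) ⟨
    α · t a + γ · S¹.ϑ t a                              ∎
  euler : (S¹.ϑ t ∗ Φ) k ≈ (inv (suc N) ℚ.* fromℕ k) · (t ^∗ suc N) k
  euler = begin
    (S¹.ϑ t ∗ Φ) k                                          ≈⟨ inv-cancel (suc N) _ ⟨
    inv (suc N) · fromℕ (suc N) · (S¹.ϑ t ∗ Φ) k            ≈⟨ P.*-congˡ (×≈· (suc N) _) ⟨
    inv (suc N) · (suc N ×ᴾ (S¹.ϑ t ∗ Φ) k)                  ≈⟨ P.*-congˡ (S¹.ϑ-^∗ t N k) ⟨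
    inv (suc N) · (k ×ᴾ (t ^∗ suc N) k)                   ≈⟨ P.*-congˡ (×≈· k _) ⟩
    inv (suc N) · fromℕ k · (t ^∗ suc N) k               ≈⟨ ·-assoc (inv (suc N)) (fromℕ k) _ ⟩
    (inv (suc N) ℚ.* fromℕ k) · (t ^∗ suc N) k           ∎
  -- N is abstracted so that its equation with y + k + j can be matched.
  step : ∀ N .{{_ : NonZero N}} → N ≡ y ℕ.+ k ℕ.+ j →
    cycleCoefficient N j (+ y) ℚ.+ (inv N ℚ.* binomial (suc N) (+ j)) ℚ.* (inv (suc N) ℚ.* fromℕ k)
    ≡ fromℕ (suc y) ℚ.* inv (suc N) ℚ.* binomial (suc N) (+ j)
  step _ ≡.refl = cycleCoefficient-step y k j

-- Lattice paths as descending words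

NonNegative : Point → Set
NonNegative a = + 0 ℤ.≤ proj₂ a

-- A descent from height y with m up-steps has y + m down-steps, so it advances by y + 2m + k j.
descends⇒path : ∀ k w y m j x → descends w y m j ≡ true →
  (All NonNegative (vertices k (x , + y) w)
    × endpoint k (x , + y) w ≡ (x ℤ.+ + (y ℕ.+ (m ℕ.+ m) ℕ.+ k ℕ.* j) , + 0))
  × # u w ≡ m × # h w ≡ j
descends⇒path k [] zero zero zero x _ =
  (ℤ.+≤+ z≤n ∷ [] , ≡.cong (_, + 0) (≡.sym (≡.trans (≡.cong (λ z → x ℤ.+ + z) (ℕ.*-zeroʳ k))
                                                       (ℤ.+-identityʳ x))))
  , ≡.refl , ≡.refl
descends⇒path k [] zero zero (suc j) x ()
descends⇒path k [] zero (suc m) j x ()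
descends⇒path k [] (suc y) m j x ()
descends⇒path k (u ∷ w) y (suc m) j x eq
  rewrite ℕ.+-comm y 1
  with (nonneg , end) , u≡ , h≡ ← descends⇒path k w (suc y) m j (x ℤ.+ + 1) eq =
  (ℤ.+≤+ z≤n ∷ nonneg , ≡.trans end (≡.cong (_, + 0) (≡.trans (ℤ.+-assoc x (+ 1) _)
    (≡.cong (λ z → x ℤ.+ + z) (shift y m (k ℕ.* j)))))) , ≡.cong suc u≡ , h≡
  where
  open +-*-Solver using (solve; con; _:+_; _:=_)
  shift : ∀ y m i → suc (suc y ℕ.+ (m ℕ.+ m) ℕ.+ i) ≡ y ℕ.+ (suc m ℕ.+ suc m) ℕ.+ i
  shift = solve 3 (λ y m i → con 2 :+ y :+ (m :+ m) :+ i := y :+ (con 1 :+ m :+ (con 1 :+ m)) :+ i) ≡.refl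
descends⇒path k (d ∷ w) (suc y) m j x eq
  with (nonneg , end) , u≡ , h≡ ← descends⇒path k w y m j (x ℤ.+ + 1) eq =
  (ℤ.+≤+ z≤n ∷ nonneg , ≡.trans end (≡.cong (_, + 0) (ℤ.+-assoc x (+ 1) _))) , u≡ , h≡
descends⇒path k (h ∷ w) y m (suc j) x eq
  with (nonneg , end) , u≡ , h≡ ← descends⇒path k w y m j (x ℤ.+ + k) eq =
  (ℤ.+≤+ z≤n ∷ nonneg , ≡.trans end (≡.cong (_, + 0) (≡.trans (ℤ.+-assoc x (+ k) _)
    (≡.cong (λ z → x ℤ.+ + z) shift)))) , u≡ , ≡.cong suc h≡
  where
  open +-*-Solver using (solve; con; _:+_; _:*_; _:=_)
  shift : k ℕ.+ (y ℕ.+ (m ℕ.+ m) ℕ.+ k ℕ.* j) ≡ y ℕ.+ (m ℕ.+ m) ℕ.+ k ℕ.* suc j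
  shift = solve 4 (λ k y m j → k :+ (y :+ (m :+ m) :+ k :* j) := y :+ (m :+ m) :+ k :* (con 1 :+ j))
            ≡.refl k y m j

path⇒descends : ∀ k w y m j x → All NonNegative (vertices k (x , + y) w) →
  proj₂ (endpoint k (x , + y) w) ≡ + 0 → # u w ≡ m → # h w ≡ j → descends w y m j ≡ true
path⇒descends k []      zero    _ _ x _            _   ≡.refl ≡.refl = ≡.refl
path⇒descends k (u ∷ w) y       _ j x (_ ∷ nonneg) end ≡.refl h≡
  rewrite ℕ.+-comm y 1 = path⇒descends k w (suc y) _ j _ nonneg end ≡.refl h≡
path⇒descends k (d ∷ w) (suc y) m j x (_ ∷ nonneg) end u≡ h≡     =
  path⇒descends k w y m j _ nonneg end u≡ h≡
-- This step would reach height -1.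
path⇒descends k (d ∷ w) zero    m j x (_ ∷ nonneg) end u≡ h≡ = contradiction (first w nonneg) λ ()
  where
  first : ∀ {a} w → All NonNegative (vertices k a w) → NonNegative a
  first []      (a≥0 ∷ _) = a≥0
  first (_ ∷ _) (a≥0 ∷ _) = a≥0
path⇒descends k (h ∷ w) y       m _ x (_ ∷ nonneg) end u≡ ≡.refl =
  path⇒descends k w y m _ _ nonneg end u≡ ≡.refl

in𝔓-descends : ∀ k m j w → does (in𝔓? k (2 ℕ.* m ℕ.+ k ℕ.* j) m j w) ≡ descends w 0 m j
in𝔓-descends k m j w = does-≡ (in𝔓? k (2 ℕ.* m ℕ.+ k ℕ.* j) m j w)
  (λ { ((nonneg , end) , u≡ , h≡) → path⇒descends k w 0 m j (+ 0) nonneg (≡.cong proj₂ end) u≡ h≡ })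
  (λ eq → case (descends⇒path k w 0 m j (+ 0) eq))
  where
  does-≡ : ∀ {A : Set} {b} (A? : Dec A) → (A → b ≡ true) → (b ≡ true → A) → does A? ≡ b
  does-≡             (yes a) f g = ≡.sym (f a)
  does-≡ {b = true}  (no ¬a) f g = contradiction (g ≡.refl) ¬a
  does-≡ {b = false} (no ¬a) f g = ≡.refl
  case : ∀ {A B C : Set} → ((A × endpoint k (+ 0 , + 0) w ≡ (+ (m ℕ.+ m ℕ.+ k ℕ.* j) , + 0)) × B × C) →
         (A × endpoint k (+ 0 , + 0) w ≡ (+ (2 ℕ.* m ℕ.+ k ℕ.* j) , + 0)) × B × C
  case ((p , end) , rest) =
    (p , ≡.trans end (≡.cong (λ z → + (m ℕ.+ z ℕ.+ k ℕ.* j) , + 0) (≡.sym (ℕ.+-identityʳ m)))) , rest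

-- The initial u-segment is not internal; the constant τ = 1 keeps it out of the weight.
Σ-𝔓 : ∀ k m j → let n = 2 ℕ.* m ℕ.+ k ℕ.* j in
  Σ[ 𝔓 k n m j ] weight ≈ total (2 ℕ.* m ℕ.+ j) (λ _ → con 1ℚ) 0 m j
Σ-𝔓 k m j = P.trans (Σ-filter (in𝔓? k n m j) weight (words (2 ℕ.* m ℕ.+ j)))
  (Σ-cong (words (2 ℕ.* m ℕ.+ j)) term)
  where
  n = 2 ℕ.* m ℕ.+ k ℕ.* j
  term : ∀ w → (if does (in𝔓? k n m j w) then weight w else con 0ℚ)
             ≈ (if descends w 0 m j then lead (λ _ → con 1ℚ) w * segments w else con 0ℚ)
  term w rewrite in𝔓-descends k m j w with descends w 0 m j
  ... | false = P.refl
  ... | true  = P.trans (weight-segments w)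
    (P.sym (P.trans (P.*-congʳ (P.reflexive (lead-one w))) (P.*-identityˡ _)))

-- The two formulas of the theorem

path-sum : ∀ k m j .{{_ : NonZero m}} .{{_ : NonZero (m ℕ.+ j)}} → let n = 2 ℕ.* m ℕ.+ k ℕ.* j in
  Σ[ 𝔓 k n m j ] weight ≈
  Σ[ 0to m ] (λ p → cycleCoefficient (m ℕ.+ j) j (+ m ℤ.- + p) · 1/! p · 𝐏 p (m ℕ.+ j) factorialVar)
path-sum k m@(suc m-1) j = begin
  Σ[ 𝔓 k _ m j ] weight
    ≈⟨ Σ-𝔓 k m j ⟩
  total (2 ℕ.* m ℕ.+ j) (λ _ → con 1ℚ) 0 m j
    ≈⟨ first-block _ (λ _ → con 1ℚ) 0 m j _ (≡.cong (λ z → m ℕ.+ z ℕ.+ j) (ℕ.+-identityʳ m)) ≡.refl ⟩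
  (K ∗ t ^∗ N) m
    -- The sum is reversed: p counts the up-steps behind the first u-segment, which has length m -
    -- p.
    ≈⟨ P.trans (S¹.∗-comm K (t ^∗ N) m) (P.sym (⋆≈∗ (t ^∗ N) K m)) ⟩
  Σ[ 0to m ] (λ p → (t ^∗ N) p * K (m ℕ.∸ p))
    ≈⟨ Σ-cong-≤ m term ⟩
  Σ[ 0to m ] (λ p → c (+ m ℤ.- + p) · 1/! p · 𝐏 p N factorialVar) ∎
  where
  N = m ℕ.+ j
  c = cycleCoefficient N j
  K : ℕ → Poly
  K a = con (c (+ a)) * con 1ℚ
  term : ∀ p → p ℕ.≤ m → (t ^∗ N) p * K (m ℕ.∸ p) ≈ c (+ m ℤ.- + p) · 1/! p · 𝐏 p N factorialVar
  term p p≤m = begin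
    (t ^∗ N) p * K (m ℕ.∸ p)   ≈⟨ P.trans (P.*-congˡ (P.*-identityʳ _)) (P.*-comm _ _) ⟩
    c (+ (m ℕ.∸ p)) · (t ^∗ N) p                    ≈⟨ P.*-cong (con-cong (≡.cong c m∸p)) (P.sym (𝐏-t p N)) ⟩
    c (+ m ℤ.- + p) · 1/! p · 𝐏 p N factorialVar    ∎
    where
    m∸p : + (m ℕ.∸ p) ≡ + m ℤ.- + p
    m∸p = ≡.sym (≡.trans (ℤ.m-n≡m⊖n m p) (ℤ.⊖-≥ p≤m))

theorem3p2 :
    ∀ (k j m : ℕ) .{{m≥1 : NonZero m}} →
    let n = 2 ℕ.* m ℕ.+ k ℕ.* j
        f = λ i → fromℕ (i !) · var i
        instance
          m+j≢0 : NonZero (m ℕ.+ j)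
          m+j≢0 = +-nonZeroˡ m j
          den≢0 : NonZero (suc m ℕ.* (m ℕ.+ j))
          den≢0 = m*n≢0 (suc m) (m ℕ.+ j)
        potentialSum =
          ∑[ p ∈ 0to m ]
            ((((+ m ℤ.- + p) ℚ./ (m ℕ.+ j)) ℚ.* binomial (m ℕ.+ j) (+ j)
              ℚ.+ ((+ m ℤ.- + p ℤ.+ + 1) ℚ./ (m ℕ.+ j)) ℚ.* binomial (m ℕ.+ j) (+ j ℤ.- + 1))
              · 1/! p · 𝐏 p (m ℕ.+ j) f)
        bellSum =
          binomial (m ℕ.+ j) (+ j) ·
          (∑[ p ∈ 0to m ]
            (((+ suc m ℤ.* (+ m ℤ.- + p) ℤ.+ + j ℤ.* (+ m ℤ.- + p ℤ.+ + 1))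
                ℚ./ (suc m ℕ.* (m ℕ.+ j)))
              · (∑[ r ∈ 0to p ]
                  ((binomial (m ℕ.+ j) (+ r) ℚ.* fromℕ (r !) ℚ.* 1/! p) · 𝐁 p r f))))
    in ((∑[ P ∈ 𝔓 k n m j ] weight P) ≈ potentialSum) × (potentialSum ≈ bellSum)
theorem3p2 k j m = path-sum k m j , P.trans (Σ-cong (0to m) term) (Σ-*ˡ (con c) _ (0to m))
  where
  N = m ℕ.+ j
  c = binomial N (+ j)
  instance
    m+j≢0 : NonZero N
    m+j≢0 = +-nonZeroˡ m j
    den≢0 : NonZero (suc m ℕ.* N)
    den≢0 = m*n≢0 (suc m) N
  -- The two sums agree for each p separately: the scalar is brought over the denominator (m + 1)(m
  -- + j), and [xᵖ] Tᴺ is expanded in Bell polynomials.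
  term : ∀ p → cycleCoefficient N j (+ m ℤ.- + p) · 1/! p · 𝐏 p N factorialVar ≈
    c · ((+ suc m ℤ.* (+ m ℤ.- + p) ℤ.+ + j ℤ.* (+ m ℤ.- + p ℤ.+ + 1)) ℚ./ (suc m ℕ.* N)) ·
      (∑[ r ∈ 0to p ] ((binomial N (+ r) ℚ.* fromℕ (r !) ℚ.* 1/! p) · 𝐁 p r factorialVar))
  term p = P.trans
    (P.*-cong (con-cong (cycleCoefficient-bell m j (+ m ℤ.- + p))) (P.trans (𝐏-t p N) (potential-bell N p)))
    (P.sym (·-assoc c _ _))
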